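{- Let $\mathcal B=(B_i)_{i\in\mathbb N}$ be any dynamical hierarchy and let $m\in\mathbb N$. Then there is $i\in\mathbb N$ such that $\mathbb G^{\mathcal B}_i(m)=0$.
   Context: Let $\mathbb N=\{0,1,2,\dots\}$; the symbol $\infty$ is regarded as greater than, and divisible by, every positive integer. For $b\ge 2$ and $n>0$, the $b$-decomposition of $n$ is the unique representation $n=b^e a+r$ with $b^e\le n<b^{e+1}$, $0<a<b$, $r<b^e$. For nonempty $B\subseteq\mathbb N\setminus\{0,1\}$ and $n\in\mathbb N$ let $\mathrm{base}_B(n)=\max\{b\in B: b\le n\}$ if $n\ge\min B$ and $\mathrm{base}_B(n)=\min B$ otherwise; let $S_B(n)=\min\{b\in B:b>n\}$ if this set is nonempty and $S_B(n)=\infty$ otherwise. A base hierarchy is a nonempty $B\subseteq\mathbb N\setminus\{0,1\}$ with $b\mid S_B(b)$ for all $b\in B$. Upgrade: for base hierarchies $B,C$ with $\min B\le\min C$, define ${\uparrow}n={\uparrow}_B^C n\in\mathbb N\cup\{\infty\}$ by recursion on $n$. If $n<\min B$, ${\uparrow}n=n$. Otherwise let $b=\mathrm{base}_B(n)$; assuming ${\uparrow}$ defined below $n$, for $c\in C$ define $\langle b\to c\rangle m$ for $m\le n$ by $\langle b\to c\rangle m={\uparrow}m$ if $m<b$, and $\langle b\to c\rangle m=c^{\langle b\to c\rangle e}\cdot{\uparrow}a+\langle b\to c\rangle r$ if $m\ge b$ has $b$-decomposition $m=b^ea+r$. Then ${\uparrow}n=\langle b\to c\rangle n$ where $c$ (the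 witness for ${\uparrow}n$) is the least element of $C$ with ${\uparrow}(n-1)<\langle b\to c\rangle n<S_C(c)$; if no such $c$ exists, ${\uparrow}n=\infty$. $C$ is a good successor of $B$ if (1) $\min B\le\min C$; (2) ${\uparrow}_B^C n<\infty$ for all $n\in\mathbb N$; (3) for every $b\in B$ with $b>\min B$, writing $x={\uparrow}_B^C(b-1)$, there is no multiple of $\mathrm{base}_C(x)$ strictly between $x$ and $S_C(x)$. A dynamical hierarchy is a sequence $\mathcal B=(B_i)_{i\in\mathbb N}$ of base hierarchies with each $B_{i+1}$ a good successor of $B_i$. The Goodstein sequence: $\mathbb G^{\mathcal B}_0(n)=n$, and $\mathbb G^{\mathcal B}_{i+1}(n)={\uparrow}_{B_i}^{B_{i+1}}\mathbb G^{\mathcal B}_i(n)-1$ if $\mathbb G^{\mathcal B}_i(n)>0$, else $\mathbb G^{\mathcal B}_{i+1}(n)=0$. -}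

module Defs where

open import Data.Nat using (ℕ; zero; suc; _+_; _*_; _∸_; _^_; _≤_; _<_)
open import Data.Nat.Divisibility using (_∣_)
open import Data.Product using (Σ; ∃; _×_; _,_; proj₁)
open import Data.Sum using (_⊎_)
open import Data.Empty using (⊥)
open import Relation.Binary.PropositionalEquality using (_≡_)

Subset : Set₁
Subset = ℕ → Set

IsMin : Subset → ℕ → Set
IsMin B b = B b × (∀ b' → B b' → b ≤ b')

-- "x < S_B(n)", where S_B(n) = min {b ∈ B : b > n}, or ∞ if that set is empty.
-- Unfolded: x is below every element of B that is above n.
_<S[_]_ : ℕ → Subset → ℕ → Set
x <S[ B ] n = ∀ b → B b → n < b → x < b

IsFiniteS : Subset → ℕ → ℕ → Set
IsFiniteS B n s = B s × n < s × (∀ b → B b → n < b → s ≤ b)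

IsBase : Subset → ℕ → ℕ → Set
IsBase B n b =
  (B b × b ≤ n × (∀ b' → B b' → b' ≤ n → b' ≤ b))
  ⊎ ((∀ b' → B b' → n < b') × IsMin B b)

-- Base hierarchy: nonempty, ⊆ ℕ∖{0,1}, b ∣ S_B(b) (trivially true when S_B(b) = ∞)
record BaseHierarchy (B : Subset) : Set where
  field
    nonempty : ∃ λ b → B b
    ≥2       : ∀ b → B b → 2 ≤ b
    divides  : ∀ b → B b → ∀ s → IsFiniteS B b s → b ∣ s

record BDecomp (b n e a r : ℕ) : Set where
  field
    lowerE : b ^ e ≤ n
    upperE : n < b ^ suc e
    a>0    : 0 < a
    a<b    : a < b
    r<     : r < b ^ e
    eqn    : n ≡ b ^ e * a + r

-- ⟨b → c⟩ m relative to a given (finite-valued) upgrade function up,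
-- as an inductive relation  Conv up b c m v  meaning  ⟨b→c⟩ m = v.
data Conv (up : ℕ → ℕ) (b c : ℕ) : ℕ → ℕ → Set where
  small : ∀ {m} → m < b → Conv up b c m (up m)
  big   : ∀ {m e a r ve vr} → b ≤ m → BDecomp b m e a r →
          Conv up b c e ve → Conv up b c r vr →
          Conv up b c m (c ^ ve * up a + vr)

Candidate : (ℕ → ℕ) → Subset → ℕ → ℕ → ℕ → Set
Candidate up C n c v = up (n ∸ 1) < v × v <S[ C ] c

UpgradeClause : Subset → Subset → (ℕ → ℕ) → ℕ → Set
UpgradeClause B C up n =
  ((∀ b → B b → n < b) → up n ≡ n)
  × (∀ b → B b → b ≤ n → (∀ b' → B b' → b' ≤ n → b' ≤ b) →
       Σ ℕ λ c → Σ ℕ λ v →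
         C c × Conv up b c n v × up n ≡ v × Candidate up C n c v
         × (∀ c' → C c' → c' < c → ∀ v' → Conv up b c' n v' →
              Candidate up C n c' v' → ⊥))

IsFiniteUpgrade : Subset → Subset → (ℕ → ℕ) → Set
IsFiniteUpgrade B C up = ∀ n → UpgradeClause B C up n

-- Good successor: (1) min B ≤ min C, (2) ↑ finite everywhere (given by the
-- function up), (3) no multiple of base_C(x) strictly between x and S_C(x),
-- for x = ↑(b-1), b ∈ B, b > min B.
record GoodSuccessor (B C : Subset) : Set₁ where
  field
    cond1 : ∀ b c → IsMin B b → IsMin C c → b ≤ c
    up    : ℕ → ℕ
    isUp  : IsFiniteUpgrade B C up
    cond3 : ∀ b → B b → (∀ β → IsMin B β → β < b) →
            ∀ β → IsBase C (up (b ∸ 1)) β →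
            ∀ k → up (b ∸ 1) < k → k <S[ C ] up (b ∸ 1) → β ∣ k → ⊥

record DynamicalHierarchy : Set₁ where
  field
    B    : ℕ → Subset
    base : ∀ i → BaseHierarchy (B i)
    good : ∀ i → GoodSuccessor (B i) (B (suc i))

G : DynamicalHierarchy → ℕ → ℕ → ℕ
G 𝓑 zero n = n
G 𝓑 (suc i) n with G 𝓑 i n
... | zero  = 0
... | suc k = GoodSuccessor.up (DynamicalHierarchy.good 𝓑 i) (suc k) ∸ 1

{-# OPTIONS --safe #-}

-- Expand n hereditarily in its base b, read b as Ω, and collapse: n receives
-- a term D μ α, where α is the expansion of n with its digits replaced by
-- their own terms, and μ is the term of the last earlier number whose
-- expansion is at least that of n.  Terms grow with n, and an upgrade leaves
-- the term unchanged: the numbers that ↑ skips just below ↑n either have a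
-- smaller expansion, by minimality of the witness, or are excluded by the
-- condition on the multiples of a base in a good successor.  So the terms
-- along a Goodstein sequence strictly decrease, and their order is
-- well-founded, as for a collapsing function into the countable ordinals.
--
-- Membership in the B i is not assumed decidable, so the term of the current
-- number is known only up to double negation.  Instead of that term, a finite
-- list of candidates (one for each finite set of possible bases) is followed:
-- each new candidate lies below an old one, and this too is well-founded.

module Submission where

open import Defs
open import Data.Nat
open import Data.Nat.Properties
open import Data.Nat.Divisibility using (_∣_; _∣?_; _∣0; ∣-refl; ∣-trans; ∣⇒≤; m∣m*n; ∣m∣n⇒∣m+n; ∣m+n∣m⇒∣n)
open import Data.Nat.DivMod using (m≡m%n+[m/n]*n; m%n<n; m≥n⇒m/n>0; m<n*o⇒m/o<n)
open import Data.Nat.Induction using (<-wellFounded)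
open import Data.Product using (∃; ∃₂; _×_; _,_; proj₁; proj₂)
open import Data.Sum using (_⊎_; inj₁; inj₂)
open import Data.Empty using (⊥; ⊥-elim)
open import Data.List using (List; []; _∷_; _++_; map; filter)
open import Data.List.Relation.Unary.Any using (here; there)
open import Data.List.Membership.Propositional using (_∈_)
open import Data.List.Membership.Propositional.Properties using (∈-++⁺ˡ; ∈-++⁺ʳ; ∈-++⁻; ∈-map⁺; ∈-map⁻; ∈-filter⁺; ∈-filter⁻)
import Data.List.Membership.DecPropositional as DecMembership
open import Induction.WellFounded using (Acc; acc; acc-inverse)
open import Relation.Nullary using (¬_; Dec; yes; no; ¬¬-excluded-middle; decidable-stable; _×-dec_)
open import Relation.Binary.PropositionalEquality using (_≡_; _≢_; refl; sym; trans; cong; cong₂; subst; subst₂; module ≡-Reasoning)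
open import Relation.Binary.Definitions using (DecidableEquality; tri<; tri≈; tri>)

-- Hereditary exponential expressions

-- big e a r stands for Ω ^ e · a + r.
data E (A : Set) : Set where
  low : A → E A
  big : E A → A → E A → E A

mapE : {A A' : Set} → (A → A') → E A → E A'
mapE f (low a)     = low (f a)
mapE f (big e a r) = big (mapE f e) (f a) (mapE f r)

data AllE {A : Set} (P : A → Set) : E A → Set where
  low : ∀ {a} → P a → AllE P (low a)
  big : ∀ {e a r} → AllE P e → P a → AllE P r → AllE P (big e a r)

AllE-map : {A : Set} {P Q : A → Set} → (∀ {a} → P a → Q a) → ∀ {ε} → AllE P ε → AllE Q ε
AllE-map f (low p)     = low (f p)
AllE-map f (big p q r) = big (AllE-map f p) (f q) (AllE-map f r)

data RelE {A A' : Set} (R : A → A' → Set) : E A → E A' → Set where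
  low : ∀ {a a'} → R a a' → RelE R (low a) (low a')
  big : ∀ {e a r e' a' r'} → RelE R e e' → R a a' → RelE R r r' →
        RelE R (big e a r) (big e' a' r')

-- The conditions on r' make this order well-founded on all expressions, so
-- that no normal form condition has to be carried along.
data LtE {A : Set} (R : A → A → Set) : E A → E A → Set where
  low-low : ∀ {a' a} → R a' a → LtE R (low a') (low a)
  low-big : ∀ {a' e a r} → LtE R (low a') (big e a r)
  exp<    : ∀ {e' a' r' e a r} → LtE R e' e → LtE R r' (big e a r) →
            LtE R (big e' a' r') (big e a r)
  coeff<  : ∀ {e' a' r' e a r} → e' ≡ e → R a' a → LtE R r' (big e a r) →
            LtE R (big e' a' r') (big e a r)
  rest<   : ∀ {e' a' r' e a r} → e' ≡ e → a' ≡ a → LtE R r' r →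
            LtE R (big e' a' r') (big e a r)

module _ {A : Set} {R : A → A → Set} (R-trans : ∀ {x y z} → R x y → R y z → R x z) where

  LtE-trans : ∀ {x y z} → LtE R x y → LtE R y z → LtE R x z
  LtE-trans (low-low p) (low-low q) = low-low (R-trans p q)
  LtE-trans (low-low p) low-big = low-big
  LtE-trans low-big (exp< _ _) = low-big
  LtE-trans low-big (coeff< _ _ _) = low-big
  LtE-trans low-big (rest< _ _ _) = low-big
  LtE-trans (exp< p r) yz@(exp< q s) = exp< (LtE-trans p q) (LtE-trans r yz)
  LtE-trans (exp< p r) yz@(coeff< refl q s) = exp< p (LtE-trans r yz)
  LtE-trans (exp< p r) yz@(rest< refl refl s) = exp< p (LtE-trans r yz)
  LtE-trans (coeff< refl p r) yz@(exp< q s) = exp< q (LtE-trans r yz)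
  LtE-trans (coeff< refl p r) yz@(coeff< refl q s) = coeff< refl (R-trans p q) (LtE-trans r yz)
  LtE-trans (coeff< refl p r) yz@(rest< refl refl s) = coeff< refl p (LtE-trans r yz)
  LtE-trans (rest< refl refl r) (exp< q s) = exp< q (LtE-trans r s)
  LtE-trans (rest< refl refl r) (coeff< refl q s) = coeff< refl q (LtE-trans r s)
  LtE-trans (rest< refl refl r) (rest< refl refl s) = rest< refl refl (LtE-trans r s)

module _ {A : Set} (_≟A_ : DecidableEquality A) where

  _≟E_ : DecidableEquality (E A)
  low a ≟E low a' with a ≟A a'
  ... | yes refl = yes refl
  ... | no a≢ = no λ { refl → a≢ refl }
  low _ ≟E big _ _ _ = no λ ()
  big _ _ _ ≟E low _ = no λ ()
  big e a r ≟E big e' a' r' with e ≟E e' | a ≟A a' | r ≟E r'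
  ... | yes refl | yes refl | yes refl = yes refl
  ... | no e≢ | _ | _ = no λ { refl → e≢ refl }
  ... | _ | no a≢ | _ = no λ { refl → a≢ refl }
  ... | _ | _ | no r≢ = no λ { refl → r≢ refl }

  module _ {R : A → A → Set} (R? : ∀ x y → Dec (R x y)) where

    -- Used to leave double negations: bases are found only classically, while comparisons of
    -- expansions are decided.
    LtE? : ∀ x y → Dec (LtE R x y)
    LtE? (low a') (low a) with R? a' a
    ... | yes p = yes (low-low p)
    ... | no ¬p = no λ { (low-low p) → ¬p p }
    LtE? (low _) (big _ _ _) = yes low-big
    LtE? (big _ _ _) (low _) = no λ ()
    LtE? (big e' a' r') y@(big e a r) with LtE? e' e | e' ≟E e | R? a' a | a' ≟A a | LtE? r' y | LtE? r' r
    ... | yes p | _ | _ | _ | yes q | _ = yes (exp< p q)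
    ... | _ | yes p | yes q | _ | yes s | _ = yes (coeff< p q s)
    ... | _ | yes p | _ | yes q | _ | yes s = yes (rest< p q s)
    ... | _ | no ¬p | _ | _ | no ¬q | _ =
      no λ { (exp< _ q) → ¬q q ; (coeff< p _ _) → ¬p p ; (rest< p _ _) → ¬p p }
    ... | no ¬p | no ¬q | _ | _ | _ | _ =
      no λ { (exp< p _) → ¬p p ; (coeff< q _ _) → ¬q q ; (rest< q _ _) → ¬q q }
    ... | no ¬p | _ | no ¬q | no ¬s | _ | _ =
      no λ { (exp< p _) → ¬p p ; (coeff< _ q _) → ¬q q ; (rest< _ s _) → ¬s s }
    ... | no ¬p | _ | no ¬q | _ | _ | no ¬s =
      no λ { (exp< p _) → ¬p p ; (coeff< _ q _) → ¬q q ; (rest< _ _ s) → ¬s s }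
    ... | _ | _ | _ | no ¬s | no ¬p | _ =
      no λ { (exp< _ p) → ¬p p ; (coeff< _ _ p) → ¬p p ; (rest< _ s _) → ¬s s }
    ... | _ | _ | _ | _ | no ¬p | no ¬s =
      no λ { (exp< _ p) → ¬p p ; (coeff< _ _ p) → ¬p p ; (rest< _ _ s) → ¬s s }

module _ {A A' : Set} {R : A → A → Set} {S : A' → A' → Set} {f : A → A'} where

  LtE-mapE : (∀ {x y} → R x y → S (f x) (f y)) → ∀ {x y} → LtE R x y → LtE S (mapE f x) (mapE f y)
  LtE-mapE h (low-low p) = low-low (h p)
  LtE-mapE h low-big = low-big
  LtE-mapE h (exp< p q) = exp< (LtE-mapE h p) (LtE-mapE h q)
  LtE-mapE h (coeff< refl p q) = coeff< refl (h p) (LtE-mapE h q)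
  LtE-mapE h (rest< refl refl q) = rest< refl refl (LtE-mapE h q)

low-injective : {A : Set} {x y : A} → _≡_ {A = E A} (low x) (low y) → x ≡ y
low-injective refl = refl

big-injective : {A : Set} {e e' : E A} {a a' : A} {r r' : E A} →
                _≡_ {A = E A} (big e a r) (big e' a' r') → e ≡ e' × a ≡ a' × r ≡ r'
big-injective refl = refl , refl , refl

mapE-injective : {A A' : Set} {f : A → A'} → (∀ {x y} → f x ≡ f y → x ≡ y) →
                 ∀ x y → mapE f x ≡ mapE f y → x ≡ y
mapE-injective inj (low _) (low _) eq = cong low (inj (low-injective eq))
mapE-injective inj (big e a r) (big e' a' r') eq with big-injective eq
... | p , q , s with mapE-injective inj e e' p | inj q | mapE-injective inj r r' s
... | refl | refl | refl = refl

module _ {A A' : Set} {R : A → A → Set} {S : A' → A' → Set} {f : A → A'} where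

  LtE-mapE⁻¹ : (∀ {x y} → S (f x) (f y) → R x y) → (∀ {x y} → f x ≡ f y → x ≡ y) →
               ∀ x y → LtE S (mapE f x) (mapE f y) → LtE R x y
  LtE-mapE⁻¹ h inj (low _) (low _) (low-low p) = low-low (h p)
  LtE-mapE⁻¹ h inj (low _) (big _ _ _) _ = low-big
  LtE-mapE⁻¹ h inj (big e' a' r') y@(big e a r) (exp< p q) =
    exp< (LtE-mapE⁻¹ h inj e' e p) (LtE-mapE⁻¹ h inj r' y q)
  LtE-mapE⁻¹ h inj (big e' a' r') y@(big e a r) (coeff< p q s) =
    coeff< (mapE-injective inj e' e p) (h q) (LtE-mapE⁻¹ h inj r' y s)
  LtE-mapE⁻¹ h inj (big e' a' r') y@(big e a r) (rest< p q s) =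
    rest< (mapE-injective inj e' e p) (inj q) (LtE-mapE⁻¹ h inj r' r s)

-- Ordinal terms

-- D μ α stands for the collapse of α above μ.
data T : Set where
  zero : T
  D    : T → E T → T

mutual
  _≟T_ : DecidableEquality T
  zero ≟T zero = yes refl
  zero ≟T D _ _ = no λ ()
  D _ _ ≟T zero = no λ ()
  D μ α ≟T D μ' α' with μ ≟T μ' | α ≟ET α'
  ... | yes refl | yes refl = yes refl
  ... | no ¬p | _ = no λ { refl → ¬p refl }
  ... | _ | no ¬p = no λ { refl → ¬p refl }

  -- Spelled out rather than taken as `_≟E_` at `_≟T_`, so that the recursion visibly descends to
  -- subterms.
  _≟ET_ : DecidableEquality (E T)
  low a ≟ET low a' with a ≟T a'
  ... | yes refl = yes refl
  ... | no a≢ = no λ { refl → a≢ refl }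
  low _ ≟ET big _ _ _ = no λ ()
  big _ _ _ ≟ET low _ = no λ ()
  big e a r ≟ET big e' a' r' with e ≟ET e' | a ≟T a' | r ≟ET r'
  ... | yes refl | yes refl | yes refl = yes refl
  ... | no e≢ | _ | _ = no λ { refl → e≢ refl }
  ... | _ | no a≢ | _ = no λ { refl → a≢ refl }
  ... | _ | _ | no r≢ = no λ { refl → r≢ refl }

-- `collapse` is the usual comparison of collapsed values: the smaller argument counts only if
-- everything it is built from already lies below the larger value.
data _<T_ : T → T → Set where
  at       : ∀ {μ α} → μ <T D μ α
  under    : ∀ {x μ α} → x <T μ → x <T D μ α
  collapse : ∀ {μ' α' μ α} → LtE _<T_ α' α → μ' <T D μ α → AllE (_<T D μ α) α' →
             D μ' α' <T D μ α

W : T → Set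
W = Acc _<T_

-- Requiring accessible coefficients in the smaller expression lets this order be shown well-founded
-- before `_<T_` is.
_◁_ : E T → E T → Set
α' ◁ α = AllE W α' × LtE _<T_ α' α

low-acc : ∀ {t} → W t → Acc _◁_ (low t)
low-acc (acc h) = acc λ { (low _ , low-low p) → low-acc (h p) }

mutual
  -- Lexicographic induction on `e`, `a`, `r`, with an inner induction on the smaller expression
  -- `x`. When the exponent or coefficient drops, the rest of `x` is also below `big e a r`, so the
  -- inner induction makes it accessible.
  big-acc : ∀ {e a r} → Acc _◁_ e → W a → Acc _◁_ r → Acc _◁_ (big e a r)
  big-acc he ha hr = acc λ (w , p) → below-big-acc he ha hr w p

  below-big-acc : ∀ {e a r x} → Acc _◁_ e → W a → Acc _◁_ r → AllE W x →
                  LtE _<T_ x (big e a r) → Acc _◁_ x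
  below-big-acc _ _ _ (low w) _ = low-acc w
  below-big-acc (acc he) ha hr (big we wa wr) (exp< p q) =
    big-acc (he (we , p)) wa (below-big-acc (acc he) ha hr wr q)
  below-big-acc he (acc ha) hr (big we wa wr) (coeff< refl p q) =
    big-acc he (ha p) (below-big-acc he (acc ha) hr wr q)
  below-big-acc he ha (acc hr) (big we wa wr) (rest< refl refl q) = big-acc he ha (hr (wr , q))

AllE-acc : ∀ {α} → AllE W α → Acc _◁_ α
AllE-acc (low w) = low-acc w
AllE-acc (big we wa wr) = big-acc (AllE-acc we) wa (AllE-acc wr)

-- Outer induction on `α`, inner induction on the derivation of `x <T D μ α`. In the case `collapse`
-- the inner induction makes `μ'` and the coefficients of `α'` accessible; hence `α' ◁ α`, and the
-- outer induction applies.
D-acc : ∀ {μ α} → Acc _◁_ α → W μ → W (D μ α)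
D-acc {μ} {α} (acc hα) wμ = acc below
  where
  mutual
    below : ∀ {x} → x <T D μ α → W x
    below at = wμ
    below (under p) = acc-inverse wμ p
    below (collapse p q s) = D-acc (hα (belowE s , p)) (below q)

    belowE : ∀ {α'} → AllE (_<T D μ α) α' → AllE W α'
    belowE (low p) = low (below p)
    belowE (big p q s) = big (belowE p) (below q) (belowE s)

mutual
  <T-wellFounded : ∀ t → W t
  <T-wellFounded zero = acc λ ()
  <T-wellFounded (D μ α) = D-acc (AllE-acc (<T-wellFoundedE α)) (<T-wellFounded μ)

  <T-wellFoundedE : ∀ α → AllE W α
  <T-wellFoundedE (low t) = low (<T-wellFounded t)
  <T-wellFoundedE (big e a r) = big (<T-wellFoundedE e) (<T-wellFounded a) (<T-wellFoundedE r)

-- Finite sets of ordinal terms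

-- Without `L' ≢ []` the empty list would lie below itself.
_≪_ : List T → List T → Set
L' ≪ L = L' ≢ [] × (∀ {t'} → t' ∈ L' → ∃ λ t → t ∈ L × t' <T t)

≪-acc-⊆ : ∀ {L M} → (∀ {t} → t ∈ L → t ∈ M) → Acc _≪_ M → Acc _≪_ L
≪-acc-⊆ L⊆M (acc h) =
  acc λ (ne , d) → h (ne , λ t'∈ → let (t , t∈ , lt) = d t'∈ in t , L⊆M t∈ , lt)

[]-acc : Acc _≪_ []
[]-acc = acc λ { {[]} (ne , _) → ⊥-elim (ne refl) ; {_ ∷ _} (_ , d) → ⊥-elim (absurd (d (here refl))) }
  where
  absurd : ∀ {t'} → ¬ (∃ λ t → t ∈ [] × t' <T t)
  absurd (_ , () , _)

-- Induction on `t`, for all accessible `L`. A list below `t ∷ L` splits into `L₁`, whose members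
-- are below `t`, and `L₂`, which is dominated by `L`; the members of `L₁` are put in front of `L₂`
-- one at a time.
∷-acc : ∀ {t L} → W t → Acc _≪_ L → Acc _≪_ (t ∷ L)
∷-acc {t} {L} (acc ht) (acc hL) = acc λ {L'} → λ (_ , d) → below L' d
  where
  Split : List T → Set
  Split L' = ∃ λ L₁ → ∃ λ L₂ → (∀ {s} → s ∈ L₁ → s <T t) × (∀ {s} → s ∈ L₂ → ∃ λ u → u ∈ L × s <T u)
             × (∀ {s} → s ∈ L' → s ∈ L₁ ++ L₂)
  split : ∀ L' → (∀ {s} → s ∈ L' → ∃ λ u → u ∈ t ∷ L × s <T u) → Split L'
  split [] d = [] , [] , (λ ()) , (λ ()) , λ ()
  split (s ∷ L') d with split L' (λ s∈ → d (there s∈)) | d (here refl)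
  ... | L₁ , L₂ , p , q , inc | .t , here refl , lt =
    s ∷ L₁ , L₂ , (λ { (here refl) → lt ; (there i) → p i }) , q ,
    λ { (here refl) → here refl ; (there i) → there (inc i) }
  ... | L₁ , L₂ , p , q , inc | u , there u∈ , lt =
    L₁ , s ∷ L₂ , p , (λ { (here refl) → u , u∈ , lt ; (there i) → q i }) , inc'
    where
    inc' : ∀ {x} → x ∈ s ∷ L' → x ∈ L₁ ++ s ∷ L₂
    inc' (here refl) = ∈-++⁺ʳ L₁ (here refl)
    inc' (there i) with ∈-++⁻ L₁ (inc i)
    ... | inj₁ j = ∈-++⁺ˡ j
    ... | inj₂ j = ∈-++⁺ʳ L₁ (there j)
  acc₂ : ∀ L₂ → (∀ {s} → s ∈ L₂ → ∃ λ u → u ∈ L × s <T u) → Acc _≪_ L₂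
  acc₂ [] q = []-acc
  acc₂ (_ ∷ _) q = hL ((λ ()) , q)
  acc₁ : ∀ L₁ {L₂} → (∀ {s} → s ∈ L₁ → s <T t) → Acc _≪_ L₂ → Acc _≪_ (L₁ ++ L₂)
  acc₁ [] p a = a
  acc₁ (s ∷ L₁) p a = ∷-acc (ht (p (here refl))) (acc₁ L₁ (λ i → p (there i)) a)
  below : ∀ L' → (∀ {s} → s ∈ L' → ∃ λ u → u ∈ t ∷ L × s <T u) → Acc _≪_ L'
  below L' d with split L' d
  ... | L₁ , L₂ , p , q , inc = ≪-acc-⊆ inc (acc₁ L₁ p (acc₂ L₂ q))

≪-wellFounded : ∀ L → Acc _≪_ L
≪-wellFounded [] = []-acc
≪-wellFounded (t ∷ L) = ∷-acc (<T-wellFounded t) (≪-wellFounded L)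

open BDecomp

-- Exponential decompositions

nonZero≥2 : ∀ {b} → 2 ≤ b → NonZero b
nonZero≥2 2≤b = >-nonZero (≤-trans (s≤s z≤n) 2≤b)

1≤^ : ∀ {b} → 1 ≤ b → ∀ e → 1 ≤ b ^ e
1≤^ {b} 1≤b e = m^n>0 b {{>-nonZero 1≤b}} e

^-monoʳ : ∀ {b e e'} → 1 ≤ b → e ≤ e' → b ^ e ≤ b ^ e'
^-monoʳ {b} 1≤b = ^-monoʳ-≤ b {{>-nonZero 1≤b}}

base≤^ : ∀ {b e} → 1 ≤ b → 1 ≤ e → b ≤ b ^ e
base≤^ {b} {e} 1≤b 1≤e = subst (_≤ b ^ e) (^-identityʳ b) (^-monoʳ 1≤b 1≤e)

n<b^n : ∀ {b} → 2 ≤ b → ∀ n → n < b ^ n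
n<b^n 2≤b zero = s≤s z≤n
n<b^n {b} 2≤b (suc n) = begin-strict
  suc n             ≤⟨ n<b^n 2≤b n ⟩
  b ^ n             <⟨ ^-monoʳ-< b 2≤b (n<1+n n) ⟩
  b ^ suc n         ∎
  where open ≤-Reasoning

digit-lex : ∀ {d a a' r r'} → a' < a → r' < d → d * a' + r' < d * a + r
digit-lex {d} {a} {a'} {r} {r'} a'<a r'<d = begin-strict
  d * a' + r'   <⟨ +-monoʳ-< (d * a') r'<d ⟩
  d * a' + d    ≡⟨ +-comm (d * a') d ⟩
  d + d * a'    ≡⟨ sym (*-suc d a') ⟩
  d * suc a'    ≤⟨ *-monoʳ-≤ d a'<a ⟩
  d * a         ≤⟨ m≤m+n (d * a) r ⟩
  d * a + r     ∎
  where open ≤-Reasoning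

digits→decomp : ∀ {b e a r} → 0 < a → a < b → r < b ^ e → BDecomp b (b ^ e * a + r) e a r
digits→decomp {b} {e} {a} {r} 0<a a<b r<d = record
  { lowerE = begin
      b ^ e           ≡⟨ sym (*-identityʳ (b ^ e)) ⟩
      b ^ e * 1       ≤⟨ *-monoʳ-≤ (b ^ e) 0<a ⟩
      b ^ e * a       ≤⟨ m≤m+n (b ^ e * a) r ⟩
      b ^ e * a + r   ∎
  ; upperE = begin-strict
      b ^ e * a + r   <⟨ digit-lex a<b r<d ⟩
      b ^ e * b + 0   ≡⟨ +-identityʳ (b ^ e * b) ⟩
      b ^ e * b       ≡⟨ *-comm (b ^ e) b ⟩
      b ^ suc e       ∎
  ; a>0 = 0<a ; a<b = a<b ; r< = r<d ; eqn = refl }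
  where open ≤-Reasoning

decomp : ∀ {b} → 2 ≤ b → ∀ n → 0 < n → ∃ λ e → ∃₂ λ a r → BDecomp b n e a r
decomp {b} 2≤b n 0<n = finish (search n (n<b^n 2≤b n))
  where
  search : ∀ k → n < b ^ k → ∃ λ e → b ^ e ≤ n × n < b ^ suc e
  search zero n<1 = ⊥-elim (<-irrefl refl (≤-trans n<1 0<n))
  search (suc k) lt with n <? b ^ k
  ... | yes n<b^k = search k n<b^k
  ... | no n≮b^k = k , ≮⇒≥ n≮b^k , lt
  finish : (∃ λ e → b ^ e ≤ n × n < b ^ suc e) → ∃ λ e → ∃₂ λ a r → BDecomp b n e a r
  finish (e , lo , hi) = e , n / d , n % d , record
    { lowerE = lo ; upperE = hi
    ; a>0 = m≥n⇒m/n>0 lo ; a<b = m<n*o⇒m/o<n hi ; r< = m%n<n n d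
    ; eqn = trans (m≡m%n+[m/n]*n n d)
                  (trans (+-comm (n % d) (n / d * d)) (cong (_+ n % d) (*-comm (n / d) d))) }
    where
    d = b ^ e
    instance
      d≢0 : NonZero d
      d≢0 = m^n≢0 b e {{nonZero≥2 2≤b}}

exponent-mono : ∀ {b n' e' a' r' n e a r} → 2 ≤ b → BDecomp b n' e' a' r' → BDecomp b n e a r →
                n' ≤ n → e' ≤ e
exponent-mono {b} {e' = e'} {e = e} 2≤b d' d n'≤n with e' ≤? e
... | yes p = p
... | no e'≰e = ⊥-elim (<-irrefl refl (<-≤-trans (upperE d)
  (≤-trans (^-monoʳ (≤-trans (s≤s z≤n) 2≤b) (≰⇒> e'≰e)) (≤-trans (lowerE d') n'≤n))))

data Lex (e' a' r' e a r : ℕ) : Set where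
  by-exp   : e' < e → Lex e' a' r' e a r
  by-coeff : e' ≡ e → a' < a → Lex e' a' r' e a r
  by-rest  : e' ≡ e → a' ≡ a → r' < r → Lex e' a' r' e a r

decomp-lex : ∀ {b n' e' a' r' n e a r} → 2 ≤ b → BDecomp b n' e' a' r' → BDecomp b n e a r →
             n' < n → Lex e' a' r' e a r
decomp-lex {b} {n'} {e'} {a'} {r'} {n} {e} {a} {r} 2≤b d' d n'<n
  with m≤n⇒m<n∨m≡n (exponent-mono 2≤b d' d (<⇒≤ n'<n))
... | inj₁ e'<e = by-exp e'<e
... | inj₂ refl with <-cmp a' a
... | tri< a'<a _ _ = by-coeff refl a'<a
... | tri> _ _ a<a' = ⊥-elim (<-asym n'<n (subst₂ _<_ (sym (eqn d)) (sym (eqn d')) (digit-lex a<a' (r< d))))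
... | tri≈ _ refl _ = by-rest refl refl
  (+-cancelˡ-< (b ^ e * a) r' r (subst₂ _<_ (eqn d') (eqn d) n'<n))

decomp-unique : ∀ {b n e' a' r' e a r} → 2 ≤ b → BDecomp b n e' a' r' → BDecomp b n e a r →
                e' ≡ e × a' ≡ a × r' ≡ r
decomp-unique {b} {n} {e'} {a'} {r'} {e} {a} {r} 2≤b d' d
  with ≤-antisym (exponent-mono 2≤b d' d ≤-refl) (exponent-mono 2≤b d d' ≤-refl)
... | refl with <-cmp a' a
... | tri< a'<a _ _ = ⊥-elim (<-irrefl (trans (sym (eqn d')) (eqn d)) (digit-lex a'<a (r< d')))
... | tri> _ _ a<a' = ⊥-elim (<-irrefl (trans (sym (eqn d)) (eqn d')) (digit-lex a<a' (r< d)))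
... | tri≈ _ refl _ = refl , refl , +-cancelˡ-≡ (b ^ e * a) r' r (trans (sym (eqn d')) (eqn d))

exponent>0 : ∀ {b n e a r} → b ≤ n → BDecomp b n e a r → 0 < e
exponent>0 {b} {e = zero} b≤n d = ⊥-elim (<-irrefl refl (≤-trans (upperE d) (subst (_≤ _) (sym (*-identityʳ b)) b≤n)))
exponent>0 {e = suc _} b≤n d = s≤s z≤n

exponent< : ∀ {b n e a r} → 2 ≤ b → BDecomp b n e a r → e < n
exponent< {e = e} 2≤b d = <-≤-trans (n<b^n 2≤b e) (lowerE d)

rest<n : ∀ {b n e a r} → BDecomp b n e a r → r < n
rest<n d = <-≤-trans (r< d) (lowerE d)

-- Hereditary expansions

data Exp (b : ℕ) : ℕ → E ℕ → Set where
  small : ∀ {m} → m < b → Exp b m (low m)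
  big   : ∀ {m e a r ε ρ} → b ≤ m → BDecomp b m e a r → Exp b e ε → Exp b r ρ →
          Exp b m (big ε a ρ)

expand : ∀ {b} → 2 ≤ b → ∀ n → ∃ (Exp b n)
expand {b} 2≤b n = go n (<-wellFounded n)
  where
  go : ∀ n → Acc _<_ n → ∃ (Exp b n)
  go n (acc rec) with n <? b
  ... | yes n<b = low n , small n<b
  ... | no n≮b with decomp 2≤b n (≤-trans (≤-trans (s≤s z≤n) 2≤b) (≮⇒≥ n≮b))
  ... | e , a , r , d =
    let (ε , p) = go e (rec (exponent< 2≤b d)) ; (ρ , q) = go r (rec (rest<n d))
    in big ε a ρ , big (≮⇒≥ n≮b) d p q

Exp-unique : ∀ {b n ε' ε} → 2 ≤ b → Exp b n ε' → Exp b n ε → ε' ≡ ε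
Exp-unique 2≤b (small _) (small _) = refl
Exp-unique 2≤b (small n<b) (big b≤n _ _ _) = ⊥-elim (<⇒≱ n<b b≤n)
Exp-unique 2≤b (big b≤n _ _ _) (small n<b) = ⊥-elim (<⇒≱ n<b b≤n)
Exp-unique 2≤b (big _ d' p' q') (big _ d p q) with decomp-unique 2≤b d' d
... | refl , refl , refl with Exp-unique 2≤b p' p | Exp-unique 2≤b q' q
... | refl | refl = refl

-- The side conditions of `LtE` on the rest hold because the rest of `n'` is less than `n'`, hence
-- less than `n`.
Exp-mono : ∀ {b n' n ε' ε} → 2 ≤ b → Exp b n' ε' → Exp b n ε → n' < n → LtE _<_ ε' ε
Exp-mono 2≤b (small _) (small _) lt = low-low lt
Exp-mono 2≤b (small _) (big _ _ _ _) lt = low-big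
Exp-mono 2≤b (big b≤n' _ _ _) (small n<b) lt = ⊥-elim (<⇒≱ (<-trans lt n<b) b≤n')
Exp-mono 2≤b (big _ d' p' q') x@(big _ d p q) lt with decomp-lex 2≤b d' d lt
... | by-exp e'<e = exp< (Exp-mono 2≤b p' p e'<e) (Exp-mono 2≤b q' x (<-trans (rest<n d') lt))
... | by-coeff refl a'<a = coeff< (Exp-unique 2≤b p' p) a'<a (Exp-mono 2≤b q' x (<-trans (rest<n d') lt))
... | by-rest refl refl r'<r = rest< (Exp-unique 2≤b p' p) refl (Exp-mono 2≤b q' q r'<r)

Exp-coeffs< : ∀ {b n ε} → 2 ≤ b → b ≤ n → Exp b n ε → AllE (_< n) ε
Exp-coeffs< {b} {n} 2≤b b≤n x = AllE-map (λ a<b → <-≤-trans a<b b≤n) (coeffs x)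
  where
  coeffs : ∀ {m ε} → Exp b m ε → AllE (_< b) ε
  coeffs (small m<b) = low m<b
  coeffs (big _ d p q) = big (coeffs p) (a<b d) (coeffs q)

eval : ℕ → E ℕ → ℕ
eval c (low v)     = v
eval c (big e a r) = c ^ eval c e * a + eval c r

Exp-eval : ∀ {b n ε} → Exp b n ε → eval b ε ≡ n
Exp-eval (small _) = refl
Exp-eval (big _ d p q) rewrite Exp-eval p | Exp-eval q = sym (eqn d)

eval-mono-base : ∀ {c c'} → 1 ≤ c → c ≤ c' → ∀ ε → eval c ε ≤ eval c' ε
eval-mono-base 1≤c c≤c' (low _) = ≤-refl
eval-mono-base {c} {c'} 1≤c c≤c' (big e a r) =
  +-mono-≤ (*-monoˡ-≤ a (≤-trans (^-monoˡ-≤ (eval c e) c≤c')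
                                 (^-monoʳ (≤-trans 1≤c c≤c') (eval-mono-base 1≤c c≤c' e))))
           (eval-mono-base 1≤c c≤c' r)

-- For an expansion of `n` in base `b` this is the remainder of `n` modulo `b`, since all other
-- exponents are positive.
lowest : E ℕ → ℕ
lowest (low v)     = v
lowest (big _ _ r) = lowest r

setLowest : ℕ → E ℕ → E ℕ
setLowest s (low _)     = low s
setLowest s (big e a r) = big e a (setLowest s r)

setLowest-lowest : ∀ ε → setLowest (lowest ε) ε ≡ ε
setLowest-lowest (low _) = refl
setLowest-lowest (big e a r) = cong (big e a) (setLowest-lowest r)

lowest-setLowest : ∀ s ε → lowest (setLowest s ε) ≡ s
lowest-setLowest s (low _) = refl
lowest-setLowest s (big _ _ r) = lowest-setLowest s r

lowest-mapE : ∀ f ε → lowest (mapE f ε) ≡ f (lowest ε)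
lowest-mapE f (low _) = refl
lowest-mapE f (big _ _ r) = lowest-mapE f r

mapE-setLowest : ∀ f s ε → mapE f (setLowest s ε) ≡ setLowest (f s) (mapE f ε)
mapE-setLowest f s (low _) = refl
mapE-setLowest f s (big e a r) = cong (big (mapE f e) (f a)) (mapE-setLowest f s r)

eval-setLowest : ∀ c s ε → eval c (setLowest s ε) ≡ eval c (setLowest 0 ε) + s
eval-setLowest c s (low _) = refl
eval-setLowest c s (big e a r) =
  trans (cong (c ^ eval c e * a +_) (eval-setLowest c s r)) (sym (+-assoc (c ^ eval c e * a) _ s))

Exp-lowest< : ∀ {b n ε} → Exp b n ε → lowest ε < b
Exp-lowest< (small n<b) = n<b
Exp-lowest< (big _ _ _ q) = Exp-lowest< q

Exp-divides : ∀ {b n ε} → Exp b n ε → lowest ε ≡ 0 → b ∣ n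
Exp-divides {b} (small _) refl = b ∣0
Exp-divides {b} {n} (big {e = e} {a} b≤n d p q) eq = subst (b ∣_) (sym (eqn d))
  (∣m∣n⇒∣m+n (∣-trans (b∣b^ e (exponent>0 b≤n d)) (m∣m*n a)) (Exp-divides q eq))
  where
  b∣b^ : ∀ e → 0 < e → b ∣ b ^ e
  b∣b^ (suc e) _ = m∣m*n (b ^ e)

Exp-setLowest : ∀ {b n ε s} → 2 ≤ b → Exp b n ε → s < b → Exp b (eval b (setLowest s ε)) (setLowest s ε)
Exp-setLowest 2≤b (small _) s<b = small s<b
Exp-setLowest {b} {s = s} 2≤b (big {e = e} {a} {r} {ε} {ρ} b≤n d p q) s<b rewrite Exp-eval p =
  big (≤-trans b≤b^e (lowerE d₁)) d₁ p q₁
  where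
  1≤b : 1 ≤ b
  1≤b = ≤-trans (s≤s z≤n) 2≤b
  b≤b^e : b ≤ b ^ e
  b≤b^e = base≤^ 1≤b (exponent>0 b≤n d)
  q₁ : Exp b (eval b (setLowest s ρ)) (setLowest s ρ)
  q₁ = Exp-setLowest 2≤b q s<b
  -- Only the size of the rest needs care: a single digit stays below `b`, and a longer rest keeps
  -- its leading exponent `e' < e`.
  bound : ∀ {r ρ} → r < b ^ e → Exp b r ρ → Exp b (eval b (setLowest s ρ)) (setLowest s ρ) →
          eval b (setLowest s ρ) < b ^ e
  bound _ (small _) _ = <-≤-trans s<b b≤b^e
  bound r<d (big {e = e'} _ d' p' _) (big _ d'' p'' _) with trans (sym (Exp-eval p'')) (Exp-eval p')
  ... | refl = <-≤-trans (upperE d'') (^-monoʳ 1≤b e'<e)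
    where
    e'<e : e' < e
    e'<e with e' <? e
    ... | yes p = p
    ... | no e'≮e = ⊥-elim (<⇒≱ r<d (≤-trans (^-monoʳ 1≤b (≮⇒≥ e'≮e)) (lowerE d')))
  d₁ : BDecomp b (b ^ e * a + eval b (setLowest s ρ)) e a (eval b (setLowest s ρ))
  d₁ = digits→decomp (a>0 d) (a<b d) (bound (r< d) q q₁)

-- Change of base

module _ {f : ℕ → ℕ} {b c : ℕ} where

  -- With `Conv→eval` this replaces the relation `Conv` by a value: map the digits of the expansion,
  -- then evaluate it at `c`.
  Exp→Conv : ∀ {n ε} → Exp b n ε → Conv f b c n (eval c (mapE f ε))
  Exp→Conv (small n<b) = small n<b
  Exp→Conv (big b≤n d p q) = big b≤n d (Exp→Conv p) (Exp→Conv q)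

  Conv→eval : ∀ {n ε v} → 2 ≤ b → Exp b n ε → Conv f b c n v → v ≡ eval c (mapE f ε)
  Conv→eval 2≤b (small _) (small _) = refl
  Conv→eval 2≤b (small n<b) (big b≤n _ _ _) = ⊥-elim (<⇒≱ n<b b≤n)
  Conv→eval 2≤b (big b≤n _ _ _) (small n<b) = ⊥-elim (<⇒≱ n<b b≤n)
  Conv→eval 2≤b (big _ d' p' q') (big _ d p q) with decomp-unique 2≤b d' d
  ... | refl , refl , refl = cong₂ (λ x y → c ^ x * _ + y) (Conv→eval 2≤b p' p) (Conv→eval 2≤b q' q)

module _ {f : ℕ → ℕ} (f-mono : ∀ {x y} → x < y → f x < f y) (f0≡0 : f 0 ≡ 0) where

  f>0 : ∀ {x} → 0 < x → 0 < f x
  f>0 {x} 0<x = subst (_< f x) f0≡0 (f-mono 0<x)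

  eval-mapE>0 : ∀ {b c n ε} → 1 ≤ c → Exp b n ε → 0 < n → 0 < eval c (mapE f ε)
  eval-mapE>0 1≤c (small _) 0<n = f>0 0<n
  eval-mapE>0 {c = c} 1≤c (big {ε = ε} _ d _ _) _ =
    ≤-trans (*-mono-≤ (1≤^ 1≤c (eval c (mapE f ε))) (f>0 (a>0 d))) (m≤m+n _ _)

  base≤eval-mapE : ∀ {b c n ε} → 1 ≤ c → b ≤ n → Exp b n ε → c ≤ eval c (mapE f ε)
  base≤eval-mapE 1≤c b≤n (small n<b) = ⊥-elim (<⇒≱ n<b b≤n)
  base≤eval-mapE {c = c} 1≤c b≤n (big {a = a} {ε = ε} {ρ = ρ} _ d p _) = begin
    c                                      ≤⟨ base≤^ 1≤c (eval-mapE>0 1≤c p (exponent>0 b≤n d)) ⟩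
    c ^ eval c (mapE f ε)                  ≡⟨ sym (*-identityʳ _) ⟩
    c ^ eval c (mapE f ε) * 1              ≤⟨ *-monoʳ-≤ (c ^ eval c (mapE f ε)) (f>0 (a>0 d)) ⟩
    c ^ eval c (mapE f ε) * f a            ≤⟨ m≤m+n _ _ ⟩
    c ^ eval c (mapE f ε) * f a + eval c (mapE f ρ) ∎
    where open ≤-Reasoning

  module _ {b c : ℕ} (2≤b : 2 ≤ b) (f<c : ∀ {a} → a < b → f a < c) where

    private
      V : E ℕ → ℕ
      V ε = eval c (mapE f ε)

      2≤c : 2 ≤ c
      2≤c = ≤-trans (s≤s (f>0 (s≤s z≤n))) (f<c 2≤b)

      1≤c : 1 ≤ c
      1≤c = ≤-trans (s≤s z≤n) 2≤c

    mutual
      -- Mutual with monotonicity of the base change: the mapped rest stays below `c ^ V ε` because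
      -- its exponent, being smaller, is mapped to a smaller one, and monotonicity in turn compares
      -- the resulting decompositions in base `c`.
      Exp-mapE : ∀ {n ε} → Exp b n ε → Exp c (eval c (mapE f ε)) (mapE f ε)
      Exp-mapE (small n<b) = small (f<c n<b)
      Exp-mapE x@(big b≤n d p q) =
        big (base≤eval-mapE 1≤c b≤n x) (decomp-mapE b≤n d p q) (Exp-mapE p) (Exp-mapE q)

      decomp-mapE : ∀ {n e a r ε ρ} → b ≤ n → BDecomp b n e a r → Exp b e ε → Exp b r ρ →
                    BDecomp c (c ^ V ε * f a + V ρ) (V ε) (f a) (V ρ)
      decomp-mapE {e = e} {ε = ε} b≤n d p (small r<b) = digits→decomp (f>0 (a>0 d)) (f<c (a<b d))
        (<-≤-trans (f<c r<b) (base≤^ 1≤c (eval-mapE>0 1≤c p (exponent>0 b≤n d))))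
      decomp-mapE {e = e} b≤n d p (big {e = e'} b≤r d' p' q') = digits→decomp (f>0 (a>0 d)) (f<c (a<b d))
        (<-≤-trans (upperE (decomp-mapE b≤r d' p' q')) (^-monoʳ 1≤c (eval-mapE-mono p' p e'<e)))
        where
        e'<e : e' < e
        e'<e with e' <? e
        ... | yes p = p
        ... | no e'≮e = ⊥-elim (<⇒≱ (r< d)
          (≤-trans (^-monoʳ (≤-trans (s≤s z≤n) 2≤b) (≮⇒≥ e'≮e)) (lowerE d')))

      eval-mapE-mono : ∀ {n' n ε' ε} → Exp b n' ε' → Exp b n ε → n' < n →
                       eval c (mapE f ε') < eval c (mapE f ε)
      eval-mapE-mono (small _) (small _) lt = f-mono lt
      eval-mapE-mono (small n'<b) x@(big b≤n _ _ _) lt = <-≤-trans (f<c n'<b) (base≤eval-mapE 1≤c b≤n x)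
      eval-mapE-mono (big b≤n' _ _ _) (small n<b) lt = ⊥-elim (<⇒≱ (<-trans lt n<b) b≤n')
      eval-mapE-mono (big {ρ = ρ'} b≤n' d' p' q') (big {ρ = ρ} b≤n d p q) lt with decomp-lex 2≤b d' d lt
      ... | by-exp e'<e = <-≤-trans (upperE (decomp-mapE b≤n' d' p' q'))
        (≤-trans (^-monoʳ 1≤c (eval-mapE-mono p' p e'<e)) (lowerE (decomp-mapE b≤n d p q)))
      ... | by-coeff refl a'<a rewrite Exp-unique 2≤b p' p =
        digit-lex (f-mono a'<a) (subst (λ ε → V ρ' < c ^ V ε) (Exp-unique 2≤b p' p) (r< (decomp-mapE b≤n' d' p' q')))
      ... | by-rest refl refl r'<r rewrite Exp-unique 2≤b p' p = +-monoʳ-< _ (eval-mapE-mono q' q r'<r)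

floor-eval : ∀ {b n ε} → Exp b n ε → n ∸ lowest ε ≡ eval b (setLowest 0 ε)
floor-eval {b} {n} {ε} x = begin
  n ∸ lowest ε                                       ≡⟨ cong (_∸ lowest ε) (sym (Exp-eval x)) ⟩
  eval b ε ∸ lowest ε                                ≡⟨ cong (λ z → eval b z ∸ lowest ε) (sym (setLowest-lowest ε)) ⟩
  eval b (setLowest (lowest ε) ε) ∸ lowest ε         ≡⟨ cong (_∸ lowest ε) (eval-setLowest b (lowest ε) ε) ⟩
  eval b (setLowest 0 ε) + lowest ε ∸ lowest ε       ≡⟨ m+n∸n≡m _ (lowest ε) ⟩
  eval b (setLowest 0 ε)                             ∎
  where open ≡-Reasoning

module _ {b n : ℕ} {ε : E ℕ} (2≤b : 2 ≤ b) (x : Exp b n ε) where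

  lowest≤ : b ≤ n → lowest ε ≤ n
  lowest≤ b≤n = ≤-trans (<⇒≤ (Exp-lowest< x)) b≤n

  Exp-floor+ : ∀ {s} → s < b → Exp b (n ∸ lowest ε + s) (setLowest s ε)
  Exp-floor+ {s} s<b = subst (λ m → Exp b m (setLowest s ε))
    (trans (eval-setLowest b s ε) (cong (_+ s) (sym (floor-eval x)))) (Exp-setLowest 2≤b x s<b)

  b≤floor : b ≤ n → b ≤ n ∸ lowest ε
  b≤floor b≤n = subst (b ≤_) (+-identityʳ _) (go x b≤n (Exp-floor+ {0} (≤-trans (s≤s z≤n) 2≤b)))
    where
    go : ∀ {ε n m} → Exp b n ε → b ≤ n → Exp b m (setLowest 0 ε) → b ≤ m
    go (small n<b) b≤n _ = ⊥-elim (<⇒≱ n<b b≤n)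
    go (big _ _ _ _) _ (big b≤m _ _ _) = b≤m

  -- Such an `n'` differs from `n` only in the last digit, so its expansion is `setLowest s ε`. In
  -- particular it is no multiple of `b`.
  lowest-above-floor : ∀ {n' ε'} → b ≤ n → n ∸ lowest ε < n' → n' < n → Exp b n' ε' →
                       0 < lowest ε' × lowest ε' < lowest ε
  lowest-above-floor {n'} {ε'} b≤n F<n' n'<n x' =
    subst (λ z → 0 < z × z < lowest ε) (sym s≡) (m<n⇒0<n∸m F<n' , s<low)
    where
    F = n ∸ lowest ε
    s = n' ∸ F
    F+s≡n' : F + s ≡ n'
    F+s≡n' = m+[n∸m]≡n (<⇒≤ F<n')
    s<low : s < lowest ε
    s<low = +-cancelˡ-< F s (lowest ε) (subst₂ _<_ (sym F+s≡n') (sym (m∸n+n≡m (lowest≤ b≤n))) n'<n)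
    s≡ : lowest ε' ≡ s
    s≡ = trans (cong lowest (Exp-unique 2≤b x'
           (subst (λ m → Exp b m (setLowest s ε)) F+s≡n' (Exp-floor+ (<-trans s<low (Exp-lowest< x))))))
           (lowest-setLowest s ε)

-- Ordinal terms of numbers

Base : Subset → ℕ → ℕ → Set
Base X n b = X b × b ≤ n × (∀ b' → X b' → b' ≤ n → b' ≤ b)

Base-unique : ∀ {X n b b'} → Base X n b → Base X n b' → b ≡ b'
Base-unique (xb , b≤n , max) (xb' , b'≤n , max') = ≤-antisym (max' _ xb b≤n) (max _ xb' b'≤n)

Base-between : ∀ {X m n b} → Base X n b → b ≤ m → m ≤ n → Base X m b
Base-between (xb , _ , max) b≤m m≤n = xb , b≤m , λ b' xb' b'≤m → max b' xb' (≤-trans b'≤m m≤n)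

findBase : ∀ {X : Subset} n → (∀ k → k ≤ n → Dec (X k)) → (∀ b → X b → n < b) ⊎ ∃ (Base X n)
findBase {X} n X? with X? n ≤-refl
... | yes xn = inj₂ (n , xn , ≤-refl , λ _ _ p → p)
findBase {X} zero X? | no ¬xn = inj₁ λ { zero x → ⊥-elim (¬xn x) ; (suc b) _ → s≤s z≤n }
findBase {X} (suc n) X? | no ¬xn with findBase n (λ k k≤n → X? k (m≤n⇒m≤1+n k≤n))
... | inj₁ none = inj₁ λ b xb → ≤∧≢⇒< (none b xb) λ { refl → ¬xn xb }
... | inj₂ (b , xb , b≤n , max) = inj₂ (b , xb , m≤n⇒m≤1+n b≤n , max')
  where
  max' : ∀ b' → X b' → b' ≤ suc n → b' ≤ b
  max' b' xb' b'≤ with m≤n⇒m<n∨m≡n b'≤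
  ... | inj₁ (s≤s b'≤n) = max b' xb' b'≤n
  ... | inj₂ refl = ⊥-elim (¬xn xb')

Principal : Subset → ℕ → E ℕ → Set
Principal X n ε = ∃ λ b → Base X n b × Exp b n ε × lowest ε ≡ 0

-- The number 0 counts as a stop so that a last stop before a positive number always exists.
data Stop (X : Subset) (ε : E ℕ) : ℕ → Set where
  origin    : Stop X ε 0
  principal : ∀ {m ε'} → Principal X m ε' → ¬ LtE _<_ ε' ε → Stop X ε m

-- Stated positively rather than as the negation of `Stop`; the two exclude each other, and they
-- exhaust all numbers when `X` is decidable.
Pass : Subset → E ℕ → ℕ → Set
Pass X ε k = 0 < k × (∀ {ε'} → Principal X k ε' → LtE _<_ ε' ε)

-- Shape X n m β says that n is assigned the term D μ α, where μ is the term
-- of m and α is β with its coefficients replaced by their terms.  For n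
-- divisible by its base, m is the last such number before n whose expansion
-- is not below that of n; otherwise D μ (low t) plays the role of μ + t.
data Shape (X : Subset) : ℕ → ℕ → E ℕ → Set where
  below     : ∀ {m} → (∀ b → X b → suc m < b) → Shape X (suc m) m (low 0)
  offset    : ∀ {n b ε} → Base X n b → Exp b n ε → 0 < lowest ε →
              Shape X n (n ∸ lowest ε) (low (lowest ε))
  principal : ∀ {n m ε} → Principal X n ε → m < n → Stop X ε m →
              (∀ {k} → m < k → k < n → Pass X ε k) → Shape X n m ε

-- A relation, because computing the term of `n` would require deciding membership in `X`;
-- `Rep-exists` gives a term for decidable `X`.
data Rep (X : Subset) : ℕ → T → Set where
  zero : Rep X 0 zero
  node : ∀ {n m β μ α} → Shape X n m β → Rep X m μ → RelE (Rep X) β α → Rep X n (D μ α)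

module _ {X : Subset} (X≥2 : ∀ b → X b → 2 ≤ b) where

  Base≥2 : ∀ {n b} → Base X n b → 2 ≤ b
  Base≥2 (xb , _) = X≥2 _ xb

  Exp-Base-unique : ∀ {n b b' ε ε'} → Base X n b → Exp b n ε → Base X n b' → Exp b' n ε' → ε ≡ ε'
  Exp-Base-unique B x B' x' with Base-unique B B'
  ... | refl = Exp-unique (Base≥2 B) x x'

  Stop-Pass-absurd : ∀ {ε k} → Stop X ε k → Pass X ε k → ⊥
  Stop-Pass-absurd origin (() , _)
  Stop-Pass-absurd (principal p ¬lt) (_ , lt) = ¬lt (lt p)

  Shape-< : ∀ {n m β} → Shape X n m β → m < n × AllE (_< n) β
  Shape-< (below _) = ≤-refl , low (s≤s z≤n)
  Shape-< (offset B@(_ , b≤n , _) x 0<low) =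
    ∸-monoʳ-< 0<low (lowest≤ (Base≥2 B) x b≤n) , low (<-≤-trans (Exp-lowest< x) b≤n)
  Shape-< (principal (_ , B@(_ , b≤n , _) , x , _) m<n _ _) = m<n , Exp-coeffs< (Base≥2 B) b≤n x

  Shape-unique : ∀ {n m β m' β'} → Shape X n m β → Shape X n m' β' → m ≡ m' × β ≡ β'
  Shape-unique (below _) (below _) = refl , refl
  Shape-unique (below none) (offset (xb , b≤ , _) _ _) = ⊥-elim (<⇒≱ (none _ xb) b≤)
  Shape-unique (below none) (principal (_ , (xb , b≤ , _) , _) _ _ _) = ⊥-elim (<⇒≱ (none _ xb) b≤)
  Shape-unique (offset (xb , b≤ , _) _ _) (below none) = ⊥-elim (<⇒≱ (none _ xb) b≤)
  Shape-unique (principal (_ , (xb , b≤ , _) , _) _ _ _) (below none) = ⊥-elim (<⇒≱ (none _ xb) b≤)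
  Shape-unique (offset B x _) (offset B' x' _) with Exp-Base-unique B x B' x'
  ... | refl = refl , refl
  Shape-unique (offset B x 0<) (principal (_ , B' , x' , ≡0) _ _ _) with Exp-Base-unique B x B' x'
  ... | refl = ⊥-elim (<⇒≢ 0< (sym ≡0))
  Shape-unique (principal (_ , B' , x' , ≡0) _ _ _) (offset B x 0<) with Exp-Base-unique B x B' x'
  ... | refl = ⊥-elim (<⇒≢ 0< (sym ≡0))
  Shape-unique {m = m} {m' = m'} (principal (_ , B , x , _) m<n st ps) (principal (_ , B' , x' , _) m'<n st' ps')
    with Exp-Base-unique B x B' x'
  ... | refl with <-cmp m m'
  ... | tri< m<m' _ _ = ⊥-elim (Stop-Pass-absurd st' (ps m<m' m'<n))
  ... | tri≈ _ refl _ = refl , refl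
  ... | tri> _ _ m'<m = ⊥-elim (Stop-Pass-absurd st (ps' m'<m m<n))

  mutual
    Rep-unique : ∀ {n t t'} → Rep X n t → Rep X n t' → t ≡ t'
    Rep-unique zero zero = refl
    Rep-unique zero (node sh _ _) = ⊥-elim (n≮0 (proj₁ (Shape-< sh)))
    Rep-unique (node sh _ _) zero = ⊥-elim (n≮0 (proj₁ (Shape-< sh)))
    Rep-unique (node sh p q) (node sh' p' q') with Shape-unique sh sh'
    ... | refl , refl = cong₂ D (Rep-unique p p') (RepE-unique q q')

    RepE-unique : ∀ {β α α'} → RelE (Rep X) β α → RelE (Rep X) β α' → α ≡ α'
    RepE-unique (low p) (low p') = cong low (Rep-unique p p')
    RepE-unique (big p q s) (big p' q' s') with RepE-unique p p' | Rep-unique q q' | RepE-unique s s'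
    ... | refl | refl | refl = refl

  -- If `n` is an offset, `n'` shares its base and floor and has a smaller digit. If `n` is
  -- principal, `n'` has been passed: either it is principal with a smaller expansion, or it carries
  -- a single digit, which is below any `big`.
  Shape-mono : ∀ {n m β n' m' β'} → Shape X n m β → Shape X n' m' β' → m < n' → n' < n → LtE _<_ β' β
  Shape-mono (below _) _ m<n' (s≤s n'≤m) = ⊥-elim (<⇒≱ m<n' n'≤m)
  Shape-mono (offset {b = b} B@(xb , b≤n , _) x _) (below none) F<n' _ =
    ⊥-elim (<⇒≱ (none b xb) (<⇒≤ (≤-<-trans (b≤floor (Base≥2 B) x b≤n) F<n')))
  Shape-mono (offset B@(xb , b≤n , _) x _) (offset B' x' _) F<n' n'<n
    with Base-unique B' (Base-between B (<⇒≤ (≤-<-trans (b≤floor (Base≥2 B) x b≤n) F<n')) (<⇒≤ n'<n))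
  ... | refl = low-low (proj₂ (lowest-above-floor (Base≥2 B) x b≤n F<n' n'<n x'))
  Shape-mono (offset B@(xb , b≤n , _) x _) (principal (_ , B' , x' , ≡0) _ _ _) F<n' n'<n
    with Base-unique B' (Base-between B (<⇒≤ (≤-<-trans (b≤floor (Base≥2 B) x b≤n) F<n')) (<⇒≤ n'<n))
  ... | refl = ⊥-elim (<⇒≢ (proj₁ (lowest-above-floor (Base≥2 B) x b≤n F<n' n'<n x')) (sym ≡0))
  -- A principal number is at least its base, so its expansion is not a single digit.
  Shape-mono (principal (_ , (_ , b≤n , _) , small n<b , _) _ _ _) _ _ _ = ⊥-elim (<⇒≱ n<b b≤n)
  Shape-mono (principal (_ , _ , big _ _ _ _ , _) _ _ _) (below _) _ _ = low-big
  Shape-mono (principal (_ , _ , big _ _ _ _ , _) _ _ _) (offset _ _ _) _ _ = low-big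
  Shape-mono (principal _ _ _ ps) (principal p' _ _ _) m<n' n'<n = proj₂ (ps m<n' n'<n) p'

  mutual
    -- The position of `n'` relative to `m` selects the constructor: `under` before `m`, `at` at
    -- `m`, and `collapse` after `m`, where `Shape-mono` compares the expansions.
    Rep-mono : ∀ {n' n t' t} → Rep X n' t' → Rep X n t → n' < n → t' <T t
    Rep-mono _ zero ()
    Rep-mono {n'} p' p@(node {m = m} sh pμ pα) n'<n with <-cmp n' m
    ... | tri< n'<m _ _ = under (Rep-mono p' pμ n'<m)
    ... | tri≈ _ refl _ = subst (_<T _) (Rep-unique pμ p') at
    Rep-mono zero (node _ _ _) _ | tri> _ _ ()
    Rep-mono (node sh' pμ' pα') p@(node sh pμ pα) n'<n | tri> _ _ m<n' =
      collapse (RepE-mono pα' pα (Shape-mono sh sh' m<n' n'<n))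
               (Rep-mono pμ' p (<-trans (proj₁ (Shape-< sh')) n'<n))
               (RepE-below pα' p (AllE-map (λ a<n' → <-trans a<n' n'<n) (proj₂ (Shape-< sh'))))

    RepE-below : ∀ {β α n t} → RelE (Rep X) β α → Rep X n t → AllE (_< n) β → AllE (_<T t) α
    RepE-below (low p') p (low lt) = low (Rep-mono p' p lt)
    RepE-below (big e' a' r') p (big le la lr) =
      big (RepE-below e' p le) (Rep-mono a' p la) (RepE-below r' p lr)

    RepE-mono : ∀ {β' α' β α} → RelE (Rep X) β' α' → RelE (Rep X) β α → LtE _<_ β' β → LtE _<T_ α' α
    RepE-mono (low p') (low p) (low-low lt) = low-low (Rep-mono p' p lt)
    RepE-mono (low _) (big _ _ _) low-big = low-big
    RepE-mono (big e' a' r') p@(big e a r) (exp< lt lr) = exp< (RepE-mono e' e lt) (RepE-mono r' p lr)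
    RepE-mono (big e' a' r') p@(big e a r) (coeff< refl lt lr) =
      coeff< (RepE-unique e' e) (Rep-mono a' a lt) (RepE-mono r' p lr)
    RepE-mono (big e' a' r') p@(big e a r) (rest< refl refl lr) =
      rest< (RepE-unique e' e) (Rep-unique a' a) (RepE-mono r' r lr)

  module _ (X? : ∀ n → Dec (X n)) where

    stop-or-pass : ∀ ε k → Stop X ε k ⊎ Pass X ε k
    stop-or-pass ε zero = inj₁ origin
    stop-or-pass ε k@(suc _) with findBase {X} k (λ j _ → X? j)
    ... | inj₁ none = inj₂ (s≤s z≤n , λ { (b , (xb , b≤k , _) , _) → ⊥-elim (<⇒≱ (none b xb) b≤k) })
    ... | inj₂ (b , B) with expand (Base≥2 B) k
    ... | ε' , x' with lowest ε' ≟ 0 | LtE? _≟_ _<?_ ε' ε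
    ... | yes ≡0 | no ¬lt = inj₁ (principal (b , B , x' , ≡0) ¬lt)
    ... | _ | yes lt = inj₂ (s≤s z≤n , λ { (_ , B₁ , x₁ , _) →
      subst (λ z → LtE _<_ z ε) (Exp-Base-unique B x' B₁ x₁) lt })
    ... | no ≢0 | _ = inj₂ (s≤s z≤n , λ { (_ , B₁ , x₁ , ≡0) →
      ⊥-elim (≢0 (trans (cong lowest (Exp-Base-unique B x' B₁ x₁)) ≡0)) })

    last-stop : ∀ ε n → 0 < n → ∃ λ m → m < n × Stop X ε m × (∀ {k} → m < k → k < n → Pass X ε k)
    last-stop ε (suc n) _ with stop-or-pass ε n
    ... | inj₁ st = n , ≤-refl , st , λ n<k → λ { (s≤s k≤n) → ⊥-elim (<⇒≱ n<k k≤n) }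
    ... | inj₂ ps with last-stop ε n (proj₁ ps)
    ... | m , m<n , st , between = m , m<n⇒m<1+n m<n , st , between'
      where
      between' : ∀ {k} → m < k → k < suc n → Pass X ε k
      between' m<k (s≤s k≤n) with m≤n⇒m<n∨m≡n k≤n
      ... | inj₁ k<n = between m<k k<n
      ... | inj₂ refl = ps

    shape : ∀ n → 0 < n → ∃₂ (Shape X n)
    shape n@(suc m) 0<n with findBase {X} n (λ j _ → X? j)
    ... | inj₁ none = m , low 0 , below none
    ... | inj₂ (b , B) with expand (Base≥2 B) n
    ... | ε , x with lowest ε ≟ 0
    ... | no ≢0 = n ∸ lowest ε , low (lowest ε) , offset B x (n≢0⇒n>0 ≢0)
    ... | yes ≡0 with last-stop ε n 0<n
    ... | m' , m'<n , st , between = m' , ε , principal (b , B , x , ≡0) m'<n st between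

    Rep-exists : ∀ n → ∃ (Rep X n)
    Rep-exists n = go n (<-wellFounded n)
      where
      go : ∀ n → Acc _<_ n → ∃ (Rep X n)
      goE : ∀ {β n} → (∀ {m} → m < n → ∃ (Rep X m)) → AllE (_< n) β → ∃ (RelE (Rep X) β)
      go zero _ = zero , zero
      go n@(suc _) (acc rec) with shape n (s≤s z≤n)
      ... | m , β , sh =
        let (m<n , β<n) = Shape-< sh
            (μ , p) = go m (rec m<n)
            (α , q) = goE (λ {k} k<n → go k (rec k<n)) β<n
        in D μ α , node sh p q
      goE h (low a<n) = let (t , p) = h a<n in low t , low p
      goE h (big e a<n r) =
        let (ε , p) = goE h e ; (t , q) = h a<n ; (ρ , s) = goE h r in big ε t ρ , big p q s

-- Locality: the term of a number depends only on the bases up to it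

Agree : ℕ → Subset → Subset → Set
Agree n X Y = ∀ k → k ≤ n → (X k → Y k) × (Y k → X k)

Agree-≤ : ∀ {m n X Y} → m ≤ n → Agree n X Y → Agree m X Y
Agree-≤ m≤n ag k k≤m = ag k (≤-trans k≤m m≤n)

Agree-sym : ∀ {n X Y} → Agree n X Y → Agree n Y X
Agree-sym ag k k≤n = proj₂ (ag k k≤n) , proj₁ (ag k k≤n)

Base-local : ∀ {n X Y b} → Agree n X Y → Base X n b → Base Y n b
Base-local ag (xb , b≤n , max) =
  proj₁ (ag _ b≤n) xb , b≤n , λ b' yb' b'≤n → max b' (proj₂ (ag b' b'≤n) yb') b'≤n

Principal-local : ∀ {n X Y ε} → Agree n X Y → Principal X n ε → Principal Y n ε
Principal-local ag (b , B , rest) = b , Base-local ag B , rest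

Shape-local : ∀ {n X Y m β} → Agree n X Y → Shape X n m β → Shape Y n m β
Shape-local {n} {Y = Y} ag (below none) = below none'
  where
  none' : ∀ b → Y b → n < b
  none' b yb with n <? b
  ... | yes n<b = n<b
  ... | no n≮b = none b (proj₂ (ag b (≮⇒≥ n≮b)) yb)
Shape-local ag (offset B x 0<) = offset (Base-local ag B) x 0<
Shape-local {X = X} {Y} ag (principal {ε = ε} p m<n st ps) = principal (Principal-local ag p) m<n (st-local (<⇒≤ m<n) st)
  λ m<k k<n → proj₁ (ps m<k k<n) , λ p' → proj₂ (ps m<k k<n) (Principal-local (Agree-sym (Agree-≤ (<⇒≤ k<n) ag)) p')
  where
  st-local : ∀ {m} → m ≤ _ → Stop X ε m → Stop Y ε m
  st-local _ origin = origin
  st-local m≤n (principal p' ¬lt) = principal (Principal-local (Agree-≤ m≤n ag) p') ¬lt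

mutual
  Rep-local : ∀ {n X Y t} → (∀ b → X b → 2 ≤ b) → Agree n X Y → Rep X n t → Rep Y n t
  Rep-local X≥2 ag zero = zero
  Rep-local X≥2 ag (node sh p q) =
    let (m<n , β<n) = Shape-< X≥2 sh
    in node (Shape-local ag sh) (Rep-local X≥2 (Agree-≤ (<⇒≤ m<n) ag) p) (RepE-local X≥2 ag β<n q)

  RepE-local : ∀ {n X Y β α} → (∀ b → X b → 2 ≤ b) → Agree n X Y → AllE (_< n) β →
               RelE (Rep X) β α → RelE (Rep Y) β α
  RepE-local X≥2 ag (low lt) (low p) = low (Rep-local X≥2 (Agree-≤ (<⇒≤ lt) ag) p)
  RepE-local X≥2 ag (big le la lr) (big e a r) =
    big (RepE-local X≥2 ag le e) (Rep-local X≥2 (Agree-≤ (<⇒≤ la) ag) a) (RepE-local X≥2 ag lr r)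

-- Membership in a base hierarchy need not be decidable, so bases are found
-- under a double negation and used only towards decidable conclusions.
¬¬-decided : ∀ (X : Subset) n → ¬ ¬ (∀ k → k ≤ n → Dec (X k))
¬¬-decided X zero ¬d = ¬¬-excluded-middle λ d → ¬d λ { zero z≤n → d }
¬¬-decided X (suc n) ¬d = ¬¬-decided X n λ ds → ¬¬-excluded-middle λ d → ¬d (extend ds d)
  where
  extend : (∀ k → k ≤ n → Dec (X k)) → Dec (X (suc n)) → ∀ k → k ≤ suc n → Dec (X k)
  extend ds d k k≤ with m≤n⇒m<n∨m≡n k≤
  ... | inj₁ (s≤s k≤n) = ds k k≤n
  ... | inj₂ refl = d

¬¬-base : ∀ (X : Subset) n → ¬ ¬ ((∀ b → X b → n < b) ⊎ ∃ (Base X n))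
¬¬-base X n ¬p = ¬¬-decided X n λ X? → ¬p (findBase n X?)

¬¬-min : ∀ {X : Subset} {b} → X b → ¬ ¬ ∃ (IsMin X)
¬¬-min {X} {b} xb = go b (<-wellFounded b) xb
  where
  go : ∀ b → Acc _<_ b → X b → ¬ ¬ ∃ (IsMin X)
  go b (acc rec) xb ¬p = ¬¬-excluded-middle {A = ∃ λ b' → b' < b × X b'} λ
    { (yes (b' , b'<b , xb')) → go b' (rec b'<b) xb' ¬p
    ; (no ¬less) → ¬p (b , xb , λ b' xb' → ≮⇒≥ λ b'<b → ¬less (b' , b'<b , xb')) }

-- Iterates the divisibility of successors: the greatest element of `X` below `d` has `d` as its
-- successor.
hierarchy-divides : ∀ {X} → BaseHierarchy X → ∀ {c d} → X c → X d → c ≤ d → c ∣ d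
hierarchy-divides {X} hX {c} {d} xc xd = go d (<-wellFounded d) xd
  where
  go : ∀ d → Acc _<_ d → X d → c ≤ d → c ∣ d
  go d (acc rec) xd c≤d with m≤n⇒m<n∨m≡n c≤d
  ... | inj₂ refl = ∣-refl
  go d@(suc d₋) (acc rec) xd c≤d | inj₁ (s≤s c≤d₋) = decidable-stable (c ∣? d) λ c∤d → ¬¬-base X d₋ λ
    { (inj₁ none) → <⇒≱ (none c xc) c≤d₋
    ; (inj₂ (d' , xd' , d'≤ , max)) → c∤d
        (∣-trans (go d' (rec (s≤s d'≤)) xd' (max c xc c≤d₋))
                 (BaseHierarchy.divides hX d' xd' d
                   (xd , s≤s d'≤ , λ x xx d'<x → ≮⇒≥ λ { (s≤s x≤) → <⇒≱ d'<x (max x xx x≤) }))) }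

-- Upgrades preserve ordinal terms

module Upgrade {B C : Subset} (hB : BaseHierarchy B) (hC : BaseHierarchy C) (gs : GoodSuccessor B C) where

  open GoodSuccessor gs
  private
    B≥2 = BaseHierarchy.≥2 hB
    C≥2 = BaseHierarchy.≥2 hC

  up-below : ∀ {n} → (∀ b → B b → n < b) → up n ≡ n
  up-below {n} = proj₁ (isUp n)

  up-0 : up 0 ≡ 0
  up-0 = up-below λ b xb → ≤-trans (s≤s z≤n) (B≥2 b xb)

  up-1 : up 1 ≡ 1
  up-1 = up-below B≥2

  up-suc : ∀ n → up n < up (suc n)
  up-suc n = decidable-stable (up n <? up (suc n)) λ ¬lt → ¬¬-base B (suc n) λ
    { (inj₁ none) → ¬lt (subst₂ _<_ (sym (up-below (λ b xb → <-trans (n<1+n n) (none b xb)))) (sym (up-below none)) (n<1+n n))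
    ; (inj₂ (b , xb , b≤ , max)) →
        let (c , v , _ , _ , eq , (lt , _) , _) = proj₂ (isUp (suc n)) b xb b≤ max
        in ¬lt (subst (up n <_) (sym eq) lt) }

  up-mono-≤ : ∀ {x y} → x ≤ y → up x ≤ up y
  up-mono : ∀ {x y} → x < y → up x < up y
  up-mono {x} {suc y} (s≤s x≤y) = ≤-<-trans (up-mono-≤ x≤y) (up-suc y)
  up-mono-≤ x≤y with m≤n⇒m<n∨m≡n x≤y
  ... | inj₁ x<y = <⇒≤ (up-mono x<y)
  ... | inj₂ refl = ≤-refl

  up-cancel-< : ∀ {x y} → up x < up y → x < y
  up-cancel-< {x} {y} lt with x <? y
  ... | yes p = p
  ... | no x≮y = ⊥-elim (<⇒≱ lt (up-mono-≤ (≮⇒≥ x≮y)))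

  up-injective : ∀ {x y} → up x ≡ up y → x ≡ y
  up-injective {x} {y} eq with <-cmp x y
  ... | tri< lt _ _ = ⊥-elim (<⇒≢ (up-mono lt) eq)
  ... | tri≈ _ p _ = p
  ... | tri> _ _ gt = ⊥-elim (<⇒≢ (up-mono gt) (sym eq))

  -- This is where the first condition on good successors is used.
  above-none : ∀ {n} → (∀ b → B b → n < b) → ∀ c → C c → n < c
  above-none {n} none c xc = decidable-stable (n <? c) λ n≮c →
    ¬¬-min (proj₂ (BaseHierarchy.nonempty hB)) λ (β , minB) →
    ¬¬-min xc λ (γ , minC) →
    n≮c (<-≤-trans (none β (proj₁ minB)) (≤-trans (cond1 β γ minB minC) (proj₂ minC c xc)))

  infix 25 _⟪_⟫
  _⟪_⟫ : E ℕ → ℕ → ℕ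
  ε ⟪ c ⟫ = eval c (mapE up ε)

  record Witness (n : ℕ) (ε : E ℕ) (c : ℕ) : Set where
    field
      member : C c
      value  : up n ≡ ε ⟪ c ⟫
      bound  : up n <S[ C ] c
      least  : ∀ {c'} → C c' → c' < c → up (n ∸ 1) < ε ⟪ c' ⟫ → ε ⟪ c' ⟫ <S[ C ] c' → ⊥

  open Witness

  witness : ∀ {n b ε} → Base B n b → Exp b n ε → ∃ (Witness n ε)
  witness {n} {b} (xb , b≤n , max) x with proj₂ (isUp n) b xb b≤n max
  ... | c , v , xc , conv , eq , (_ , v<S) , minimal = c , record
    { member = xc
    ; value = trans eq (Conv→eval (B≥2 b xb) x conv)
    ; bound = subst (_<S[ C ] c) (sym eq) v<S
    ; least = λ {c'} xc' c'<c lt lts → minimal c' xc' c'<c _ (Exp→Conv x) (lt , lts) }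

  C≥1 : ∀ {c} → C c → 1 ≤ c
  C≥1 xc = ≤-trans (s≤s z≤n) (C≥2 _ xc)

  -- Since `b ≤ n`, the value at `c` is at least `c`; the bound by the successor of `c` excludes
  -- larger elements of `C`.
  witness-base : ∀ {n b ε c} → Base B n b → Exp b n ε → Witness n ε c → Base C (up n) c
  witness-base {n} {b} {ε} {c} (_ , b≤n , _) x w =
    member w ,
    subst (c ≤_) (sym (value w)) (base≤eval-mapE up-mono up-0 (C≥1 (member w)) b≤n x) ,
    λ c' xc' c'≤ → ≮⇒≥ λ c<c' → <⇒≱ (bound w c' xc' c<c') c'≤

  base-mono : ∀ {x y c d} → Base C x c → Base C y d → x ≤ y → c ≤ d
  base-mono (xc , c≤x , _) (_ , _ , max) x≤y = max _ xc (≤-trans c≤x x≤y)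

  -- The expansion `b ^ 1 * 1 + 0` of any base `b` in itself.
  Ω : E ℕ
  Ω = big (low 1) 1 (low 0)

  Exp-self : ∀ {b} → 2 ≤ b → Exp b b Ω
  Exp-self {b} 2≤b = big ≤-refl
    (subst (λ n → BDecomp b n 1 1 0)
      (trans (+-identityʳ _) (trans (*-identityʳ _) (^-identityʳ b)))
      (digits→decomp {b} {1} (s≤s z≤n) 2≤b (subst (0 <_) (sym (^-identityʳ b)) 0<b)))
    (small 2≤b) (small 0<b)
    where
    0<b : 0 < b
    0<b = ≤-trans (s≤s z≤n) 2≤b

  Ω-value : ∀ c → Ω ⟪ c ⟫ ≡ c
  Ω-value c rewrite up-1 | up-0 = trans (+-identityʳ _) (trans (*-identityʳ _) (^-identityʳ c))

  -- Induction from `n` down to `b`. At `b` the upgrade equals the witness and `up` is increasing;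
  -- above `b` the witnesses do not decrease, being the bases of increasing numbers.
  digit<witness : ∀ {n b ε c} → Base B n b → Exp b n ε → Witness n ε c → ∀ {a} → a < b → up a < c
  digit<witness {n} = go n
    where
    go : ∀ n {b ε c} → Base B n b → Exp b n ε → Witness n ε c → ∀ {a} → a < b → up a < c
    go n {b} (xb , b≤n , max) x w {a} a<b with m≤n⇒m<n∨m≡n b≤n
    ... | inj₂ refl = subst (up a <_)
      (trans (value w) (trans (cong (_⟪ _ ⟫) (Exp-unique (B≥2 b xb) x (Exp-self (B≥2 b xb)))) (Ω-value _)))
      (up-mono a<b)
    go (suc n) {b} Bn@(xb , _ , _) x w {a} a<b | inj₁ (s≤s b≤n) =
      <-≤-trans (go n Bn₋ x₋ w₋ a<b)
        (base-mono (witness-base Bn₋ x₋ w₋) (witness-base Bn x w) (<⇒≤ (up-suc n)))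
      where
      Bn₋ = Base-between Bn b≤n (n≤1+n n)
      x₋ = proj₂ (expand (B≥2 b xb) n)
      w₋ = proj₂ (witness Bn₋ x₋)

  Exp-up : ∀ {n b ε c} → Base B n b → Exp b n ε → Witness n ε c → Exp c (up n) (mapE up ε)
  Exp-up {c = c} Bn x w = subst (λ v → Exp c v (mapE up _)) (sym (value w))
    (Exp-mapE up-mono up-0 (B≥2 _ (proj₁ Bn)) (digit<witness Bn x w) x)

  module _ {n b ε} (Bn : Base B n b) (x : Exp b n ε) where
    private
      2≤b = B≥2 b (proj₁ Bn)
      b≤n = proj₁ (proj₂ Bn)
      F = n ∸ lowest ε
      low≤ : lowest ε ≤ n
      low≤ = lowest≤ 2≤b x b≤n
      b≤F : b ≤ F
      b≤F = b≤floor 2≤b x b≤n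

      F+-base : ∀ {s} → s ≤ lowest ε → Base B (F + s) b
      F+-base {s} s≤ = Base-between Bn (≤-trans b≤F (m≤m+n F s))
        (subst (F + s ≤_) (m∸n+n≡m low≤) (+-monoʳ-≤ F s≤))

      s<b : ∀ {s} → s ≤ lowest ε → s < b
      s<b s≤ = ≤-<-trans s≤ (Exp-lowest< x)

      F+-exp : ∀ {s} → s ≤ lowest ε → Exp b (F + s) (setLowest s ε)
      F+-exp s≤ = Exp-floor+ 2≤b x (s<b s≤)

      F-base : Base B F b
      F-base = subst (λ m → Base B m b) (+-identityʳ F) (F+-base z≤n)

      F-exp : Exp b F (setLowest 0 ε)
      F-exp = subst (λ m → Exp b m (setLowest 0 ε)) (+-identityʳ F) (F+-exp z≤n)

      c = proj₁ (witness F-base F-exp)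
      wF : Witness F (setLowest 0 ε) c
      wF = proj₂ (witness F-base F-exp)

      value-split : ∀ d s → setLowest s ε ⟪ d ⟫ ≡ (setLowest 0 ε ⟪ d ⟫) + up s
      value-split d s rewrite mapE-setLowest up s ε | mapE-setLowest up 0 ε | up-0 =
        eval-setLowest d (up s) (mapE up ε)

      c∣upF : c ∣ up F
      c∣upF = Exp-divides (Exp-up F-base F-exp wF)
        (trans (lowest-mapE up (setLowest 0 ε)) (trans (cong up (lowest-setLowest 0 ε)) up-0))

    -- Because c divides every later element of C, adding a digit to a
    -- multiple of c never reaches the next base, so the witness is kept.
    witness-floor : ∀ s → s ≤ lowest ε → Witness (F + s) (setLowest s ε) c
    witness-floor zero _ = subst (λ m → Witness m (setLowest 0 ε) c) (sym (+-identityʳ F)) wF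
    witness-floor (suc s) s<low with witness (F+-base s<low) (F+-exp s<low)
    ... | c' , w' = keep (m≤n⇒m<n∨m≡n c≤c')
      where
      w : Witness (F + s) (setLowest s ε) c
      w = witness-floor s (<⇒≤ s<low)
      F+s<  : F + s < F + suc s
      F+s< = +-monoʳ-< F (n<1+n s)
      c≤c' : c ≤ c'
      c≤c' = base-mono (witness-base (F+-base (<⇒≤ s<low)) (F+-exp (<⇒≤ s<low)) w)
        (witness-base (F+-base s<low) (F+-exp s<low) w') (<⇒≤ (up-mono F+s<))
      digit< : ∀ {a} → a < b → up a < c
      digit< = digit<witness F-base F-exp wF
      above : up (F + suc s ∸ 1) < setLowest (suc s) ε ⟪ c ⟫
      above = subst (_< setLowest (suc s) ε ⟪ c ⟫)
        (trans (sym (value w)) (cong up (sym (cong (_∸ 1) (+-suc F s)))))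
        (eval-mapE-mono up-mono up-0 2≤b digit< (F+-exp (<⇒≤ s<low)) (F+-exp s<low) F+s<)
      bounded : setLowest (suc s) ε ⟪ c ⟫ <S[ C ] c
      bounded d xd c<d = subst (_< d) (sym (trans (value-split c (suc s)) (cong (_+ up (suc s)) (sym (value wF)))))
        (<-≤-trans (+-monoʳ-< (up F) (digit< (s<b s<low))) upF+c≤d)
        where
        upF<d : up F < d
        upF<d = bound wF d xd c<d
        F+gap : up F + (d ∸ up F) ≡ d
        F+gap = m+[n∸m]≡n (<⇒≤ upF<d)
        c∣gap : c ∣ d ∸ up F
        c∣gap = ∣m+n∣m⇒∣n (subst (c ∣_) (sym F+gap) (hierarchy-divides hC (member wF) xd (<⇒≤ c<d))) c∣upF
        upF+c≤d : up F + c ≤ d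
        upF+c≤d = subst (up F + c ≤_) F+gap
          (+-monoʳ-≤ (up F) (∣⇒≤ {{>-nonZero (m<n⇒0<n∸m upF<d)}} c∣gap))
      keep : c < c' ⊎ c ≡ c' → Witness (F + suc s) (setLowest (suc s) ε) c
      -- By `above` and `bounded`, `c` already qualifies as witness for `F + suc s`, against the
      -- minimality of `c'`.
      keep (inj₁ c<c') = ⊥-elim (least w' (member wF) c<c' above bounded)
      keep (inj₂ refl) = w'

    up-floor+ : ∀ {s} → s ≤ lowest ε → up (F + s) ≡ up F + up s
    up-floor+ {s} s≤ = trans (value (witness-floor s s≤))
      (trans (value-split c s) (cong (_+ up s) (sym (value wF))))

    up-floor : up F ≡ up n ∸ up (lowest ε)
    up-floor = sym (trans (cong (_∸ up (lowest ε)) (trans (cong up (sym (m∸n+n≡m low≤))) (up-floor+ ≤-refl)))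
      (m+n∸n≡m (up F) (up (lowest ε))))

  up-interval : ∀ {m y} n → up m < y → y ≤ up n → ∃ λ k → m ≤ k × k < n × up k < y × y ≤ up (suc k)
  up-interval {m} zero um<y y≤ = ⊥-elim (n≮0 (up-cancel-< (<-≤-trans um<y y≤)))
  up-interval {m} {y} (suc n) um<y y≤ with y ≤? up n
  ... | no y≰ = n , ≤-pred (up-cancel-< (<-≤-trans um<y y≤)) , ≤-refl , ≰⇒> y≰ , y≤
  ... | yes y≤n with up-interval n um<y y≤n
  ... | k , m≤k , k<n , p , q = k , m≤k , m<n⇒m<1+n k<n , p , q

  -- A number skipped by ↑ just below ↑k has a smaller expansion than ↑k:
  -- otherwise its base would have been an earlier witness for ↑k.
  skipped-expansion : ∀ {k b ε y c' δ} → Base B (suc k) b → b ≤ k → Exp b (suc k) ε →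
                      up k < y → y < up (suc k) → Base C y c' → Exp c' y δ → LtE _<_ δ (mapE up ε)
  skipped-expansion {k} {b} {ε} {y} {c'} {δ} Bk b≤k x uk<y y<uk' Cy z with witness Bk x
  ... | c , w = conclude (m≤n⇒m<n∨m≡n (base-mono Cy (witness-base Bk x w) (<⇒≤ y<uk')))
    where
    2≤b = B≥2 b (proj₁ Bk)
    c'≥2 = C≥2 c' (proj₁ Cy)
    Bk₋ = Base-between Bk b≤k (n≤1+n k)
    ε₋ = proj₁ (expand 2≤b k)
    x₋ : Exp b k ε₋
    x₋ = proj₂ (expand 2≤b k)
    c₋ = proj₁ (witness Bk₋ x₋)
    w₋ : Witness k ε₋ c₋
    w₋ = proj₂ (witness Bk₋ x₋)
    c₋≤c' : c₋ ≤ c'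
    c₋≤c' = base-mono (witness-base Bk₋ x₋ w₋) Cy (<⇒≤ uk<y)
    digit< : ∀ {a} → a < b → up a < c'
    digit< a<b = <-≤-trans (digit<witness Bk₋ x₋ w₋ a<b) c₋≤c'
    -- Raising the base from the witness `c₋` of `k` to `c'` does not lower the value of `k`, and at
    -- `c'` the value of `suc k` is greater still.
    above : up k < ε ⟪ c' ⟫
    above = ≤-<-trans (≤-trans (≤-reflexive (value w₋)) (eval-mono-base (C≥1 (member w₋)) c₋≤c' (mapE up ε₋)))
      (eval-mapE-mono up-mono up-0 2≤b digit< x₋ x (n<1+n k))
    conclude : c' < c ⊎ c' ≡ c → LtE _<_ δ (mapE up ε)
    conclude (inj₂ refl) = Exp-mono c'≥2 z (Exp-up Bk x w) y<uk'
    conclude (inj₁ c'<c) with y <? ε ⟪ c' ⟫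
    ... | yes y<v = Exp-mono c'≥2 z (Exp-mapE up-mono up-0 2≤b digit< x) y<v
    -- The value at `c'` is at most `y`, whose base is `c'`, so it stays below the successor of
    -- `c'`.
    ... | no y≮v = ⊥-elim (least w (proj₁ Cy) c'<c above
      λ d xd c'<d → ≤-<-trans (≮⇒≥ y≮v) (≰⇒> λ d≤y → <⇒≱ c'<d (proj₂ (proj₂ Cy) d xd d≤y)))

  -- This is where the third condition on good successors is used.
  no-principal-below-base : ∀ {k y δ} → B (suc k) → up k < y → y < up (suc k) → ¬ Principal C y δ
  no-principal-below-base {k} {y} {δ} xb uk<y y<ub (c' , Cy@(xc' , c'≤y , max) , z , ≡0) =
    -- Here `suc k` is the minimum of `B`, which `cond3` does not cover; but then `up k` is `k`,
    -- which lies below all of `C`.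
    ¬¬-base B k λ { (inj₁ none) → <⇒≱ (above-none none c' xc') (≤-trans c'≤uk (≤-reflexive (up-below none)))
                  ; (inj₂ (β , xβ , β≤k , _)) →
                      cond3 (suc k) xb (λ β' minβ' → s≤s (≤-trans (proj₂ minβ' β xβ) β≤k))
                        c' (inj₁ (Base-between Cy c'≤uk (<⇒≤ uk<y))) y uk<y
                        (λ d xd uk<d → ≰⇒> λ d≤y → <⇒≱ uk<d (≤-trans (max d xd d≤y) c'≤uk))
                        (Exp-divides z ≡0) }
    where
    2≤b = B≥2 (suc k) xb
    Bb : Base B (suc k) (suc k)
    Bb = xb , ≤-refl , λ _ _ p → p
    c = proj₁ (witness Bb (Exp-self 2≤b))
    w : Witness (suc k) Ω c
    w = proj₂ (witness Bb (Exp-self 2≤b))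
    -- The base `suc k` has value `c'` at `c'`, so if `c'` exceeded `up k` it would be a witness
    -- earlier than `c`.
    c'≤uk : c' ≤ up k
    c'≤uk = ≮⇒≥ λ uk<c' → least w xc'
      (<-≤-trans (≤-<-trans c'≤y y<ub) (≤-reflexive (trans (value w) (Ω-value c))))
      (subst (up k <_) (sym (Ω-value c')) uk<c')
      λ d xd c'<d → subst (_< d) (sym (Ω-value c')) c'<d

  Principal-up : ∀ {n ε} → Principal B n ε → Principal C (up n) (mapE up ε)
  Principal-up {n} {ε} (b , Bn , x , ≡0) with witness Bn x
  ... | c , w = c , witness-base Bn x w , Exp-up Bn x w , trans (lowest-mapE up ε) (trans (cong up ≡0) up-0)

  Principal-up⁻¹ : ∀ {n b ε δ} → Base B n b → Exp b n ε → Principal C (up n) δ →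
                   Principal B n ε × δ ≡ mapE up ε
  Principal-up⁻¹ {n} {b} {ε} {δ} Bn x (c' , Cn , z , ≡0) with witness Bn x
  ... | c , w with Exp-Base-unique C≥2 Cn z (witness-base Bn x w) (Exp-up Bn x w)
  ... | refl = (b , Bn , x , up-injective (trans (trans (sym (lowest-mapE up ε)) ≡0) (sym up-0))) , refl

  -- By `up-floor`, removing the last digit commutes with `up`. The floor of `up (suc k)` is thus at
  -- most `up k`, so `y` lies strictly between this floor and `up (suc k)` and has a nonzero last
  -- digit.
  no-principal-offset : ∀ {k b ε y δ} → Base B (suc k) b → Exp b (suc k) ε → 0 < lowest ε →
                        up k < y → y < up (suc k) → ¬ Principal C y δ
  no-principal-offset {k} {b} {ε} {y} {δ} Bk x 0<low uk<y y<uk' (c' , Cy , z , ≡0) =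
    <⇒≢ (proj₁ (lowest-above-floor c≥2 x' c≤ F<y y<uk' z')) (sym ≡0)
    where
    c = proj₁ (witness Bk x)
    w : Witness (suc k) ε c
    w = proj₂ (witness Bk x)
    c≥2 = C≥2 c (member w)
    x' = Exp-up Bk x w
    Cb = witness-base Bk x w
    c≤ = proj₁ (proj₂ Cb)
    F≤k : suc k ∸ lowest ε ≤ k
    F≤k = ≤-pred (∸-monoʳ-< 0<low (lowest≤ (B≥2 b (proj₁ Bk)) x (proj₁ (proj₂ Bk))))
    F<y : up (suc k) ∸ lowest (mapE up ε) < y
    F<y = ≤-<-trans (≤-reflexive (trans (cong (up (suc k) ∸_) (lowest-mapE up ε)) (sym (up-floor Bk x))))
      (≤-<-trans (up-mono-≤ F≤k) uk<y)
    z' : Exp c y δ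
    z' = subst (λ d → Exp d y δ) (Base-unique Cy (Base-between Cb
      (≤-trans (b≤floor c≥2 x' c≤) (<⇒≤ F<y)) (<⇒≤ y<uk'))) z

  -- The principal case is the main one. Stops are carried over because `mapE up` reflects `LtE`. A
  -- number `y` strictly between `up m` and `up n` satisfies `up k < y` and `y ≤ up (suc k)` for
  -- some `k`: if `y` is the upper end, it inherits the passing of `suc k`; otherwise it is skipped
  -- by `up`.
  Shape-up : ∀ {n m β} → Shape B n m β → Shape C (up n) (up m) (mapE up β)
  Shape-up {suc m} (below none)
    rewrite up-below none | up-below (λ b xb → <-trans (n<1+n m) (none b xb)) | up-0 = below (above-none none)
  Shape-up {n} (offset {ε = ε} Bn x 0<low) with witness Bn x
  ... | c , w = subst₂ (Shape C (up n)) (trans (cong (up n ∸_) (lowest-mapE up ε)) (sym (up-floor Bn x)))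
    (cong low (lowest-mapE up ε))
    (offset (witness-base Bn x w) (Exp-up Bn x w)
      (subst (0 <_) (sym (lowest-mapE up ε)) (subst (_< up (lowest ε)) up-0 (up-mono 0<low))))
  Shape-up {n} {m} (principal {ε = ε} p@(b , Bn , x , ≡0) m<n st ps) =
    principal (Principal-up p) (up-mono m<n) (stop st)
      λ {y} um<y y<un → ≤-<-trans z≤n um<y , λ {δ} q →
        decidable-stable (LtE? _≟_ _<?_ δ (mapE up ε)) λ ¬lt → pass ¬lt um<y y<un q
    where
    stop : ∀ {m} → Stop B ε m → Stop C (mapE up ε) (up m)
    stop origin = subst (Stop C (mapE up ε)) (sym up-0) origin
    stop (principal {ε' = ε'} p' ¬lt) =
      principal (Principal-up p') λ lt → ¬lt (LtE-mapE⁻¹ up-cancel-< up-injective ε' ε lt)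

    -- For `k < n` the expansion `δ` is below `ε`, as `k` is passed; for `k` equal to `n` it is `ε`.
    earlier : ∀ {k δ} → m < k → k ≤ n → Principal B k δ → ∀ {δ'} → ¬ LtE _<_ δ' (mapE up ε) →
              ¬ LtE _<_ δ' (mapE up δ)
    earlier m<k k≤n q ¬lt lt with m≤n⇒m<n∨m≡n k≤n
    ... | inj₁ k<n = ¬lt (LtE-trans <-trans lt (LtE-mapE up-mono (proj₂ (ps m<k k<n) q)))
    ... | inj₂ refl with q
    ... | _ , Bn' , x' , _ with Exp-Base-unique B≥2 Bn' x' Bn x
    ... | refl = ¬lt lt

    skipped : ∀ {k y δ b'} → Dec (b' ≤ k) → m ≤ k → k < n → up k < y → y < up (suc k) → Base B (suc k) b' →
              Principal C y δ → ¬ ¬ LtE _<_ δ (mapE up ε)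
    -- The base of `suc k` exceeds `k`, so `suc k` is itself a base; the other cases have a base
    -- shared with `k`.
    skipped (no b'≰k) m≤k k<n uk<y y<uk' (xb' , b'≤ , _) q ¬lt with ≤-antisym b'≤ (≰⇒> b'≰k)
    ... | refl = no-principal-below-base xb' uk<y y<uk' q
    skipped {k} (yes b'≤k) m≤k k<n uk<y y<uk' Bk q@(_ , Cy , z , _) ¬lt with expand (B≥2 _ (proj₁ Bk)) (suc k)
    ... | ε' , x' with lowest ε' ≟ 0
    ... | no ≢0 = no-principal-offset Bk x' (n≢0⇒n>0 ≢0) uk<y y<uk' q
    ... | yes ≡0' = earlier (s≤s m≤k) k<n (_ , Bk , x' , ≡0') ¬lt (skipped-expansion Bk b'≤k x' uk<y y<uk' Cy z)

    pass : ∀ {y δ} → ¬ LtE _<_ δ (mapE up ε) → up m < y → y < up n → ¬ Principal C y δ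
    pass {y} {δ} ¬lt um<y y<un q@(_ , Cy@(xc , c≤y , _) , _) with up-interval n um<y (<⇒≤ y<un)
    ... | k , m≤k , k<n , uk<y , y≤uk' = ¬¬-base B (suc k) λ
      { (inj₁ none) → <⇒≱ (above-none none _ xc) (≤-trans c≤y (≤-trans y≤uk' (≤-reflexive (up-below none))))
      ; (inj₂ (b' , Bk)) → cases b' Bk (m≤n⇒m<n∨m≡n y≤uk') }
      where
      cases : ∀ b' → Base B (suc k) b' → y < up (suc k) ⊎ y ≡ up (suc k) → ⊥
      cases b' Bk (inj₁ y<uk') = skipped (b' ≤? k) m≤k k<n uk<y y<uk' Bk q ¬lt
      cases b' Bk (inj₂ refl) with expand (B≥2 _ (proj₁ Bk)) (suc k)
      ... | ε' , x' with Principal-up⁻¹ Bk x' q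
      ... | q' , refl = ¬lt (LtE-mapE up-mono (proj₂ (ps (s≤s m≤k) (up-cancel-< y<un)) q'))

  mutual
    Rep-up : ∀ {n t} → Rep B n t → Rep C (up n) t
    Rep-up zero = subst (λ n → Rep C n zero) (sym up-0) zero
    Rep-up (node sh p q) = node (Shape-up sh) (Rep-up p) (RepE-up q)

    RepE-up : ∀ {β α} → RelE (Rep B) β α → RelE (Rep C) (mapE up β) α
    RepE-up (low p) = low (Rep-up p)
    RepE-up (big p q s) = big (RepE-up p) (Rep-up q) (RepE-up s)

open DecMembership _≟_ using () renaming (_∈?_ to _∈ℕ?_)
open DecMembership _≟T_ using () renaming (_∈?_ to _∈T?_)

-- Candidate terms

-- The members are sets of numbers below `N`, hence the argument `suc u` wherever bases up to `u`
-- matter.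
subsets : ℕ → List (List ℕ)
subsets zero    = [] ∷ []
subsets (suc N) = map (N ∷_) (subsets N) ++ subsets N

-- The condition `2 ≤ k` makes every list, whatever its entries, a decidable set to which the
-- results on terms apply.
Listed : List ℕ → Subset
Listed l k = k ∈ l × 2 ≤ k

Listed≥2 : ∀ l b → Listed l b → 2 ≤ b
Listed≥2 l b = proj₂

¬¬-listed : ∀ {X : Subset} → (∀ b → X b → 2 ≤ b) → ∀ n →
            ¬ ¬ (∃ λ l → l ∈ subsets (suc n) × Agree n (Listed l) X)
¬¬-listed {X} X≥2 n ¬p = go (suc n) λ (l , l∈ , sound , complete) →
  ¬p (l , l∈ , λ k k≤n → (λ (k∈ , _) → sound k∈) , λ xk → complete (s≤s k≤n) xk , X≥2 k xk)
  where
  go : ∀ N → ¬ ¬ (∃ λ l → l ∈ subsets N × (∀ {k} → k ∈ l → X k) × (∀ {k} → k < N → X k → k ∈ l))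
  go zero ¬p = ¬p ([] , here refl , (λ ()) , λ ())
  go (suc N) ¬p = go N λ (l , l∈ , sound , complete) → ¬¬-excluded-middle {A = X N} λ
    { (yes xN) → ¬p (N ∷ l , ∈-++⁺ˡ (∈-map⁺ (N ∷_) l∈) ,
        (λ { (here refl) → xN ; (there k∈) → sound k∈ }) ,
        λ k<1+N xk → cons complete k<1+N xk)
    ; (no ¬xN) → ¬p (l , ∈-++⁺ʳ _ l∈ , sound ,
        λ k<1+N xk → complete (≤∧≢⇒< (≤-pred k<1+N) λ { refl → ¬xN xk }) xk) }
    where
    cons : ∀ {l} → (∀ {k} → k < N → X k → k ∈ l) → ∀ {k} → k < suc N → X k → k ∈ N ∷ l
    cons complete (s≤s k≤N) xk with m≤n⇒m<n∨m≡n k≤N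
    ... | inj₁ k<N = there (complete k<N xk)
    ... | inj₂ refl = here refl

Listed-Rep : ∀ l n → ∃ (Rep (Listed l) n)
Listed-Rep l = Rep-exists (Listed≥2 l) λ k → (k ∈ℕ? l) ×-dec (2 ≤? k)

term : List ℕ → ℕ → T
term l n = proj₁ (Listed-Rep l n)

module _ (L : List T) (u : ℕ) where

  -- Keeps the possible sets of bases under which the term of `u` is among those followed, and
  -- records what they assign to `u ∸ 1`, the next number of the sequence when `u` is the upgrade.
  candidates : List T
  candidates = map (λ l → term l (u ∸ 1)) (filter (λ l → term l u ∈T? L) (subsets (suc u)))

  candidates-dominated : 0 < u → ∀ {t'} → t' ∈ candidates → ∃ λ t → t ∈ L × t' <T t
  candidates-dominated 0<u t'∈ with ∈-map⁻ (λ l → term l (u ∸ 1)) t'∈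
  ... | l , l∈ , refl = term l u , proj₂ (∈-filter⁻ (λ l → term l u ∈T? L) {xs = subsets (suc u)} l∈) ,
    Rep-mono (Listed≥2 l) (proj₂ (Listed-Rep l (u ∸ 1))) (proj₂ (Listed-Rep l u)) (∸-monoʳ-< (s≤s z≤n) 0<u)

  -- Some list agrees with `X` up to `u`; by locality it gives `u` and `u ∸ 1` the same terms as
  -- `X`, so the filter retains it.
  candidates-complete : ∀ {X t} → (∀ b → X b → 2 ≤ b) → t ∈ L → Rep X u t →
                        ¬ ¬ (∃ λ t' → t' ∈ candidates × Rep X (u ∸ 1) t')
  candidates-complete {X} {t} X≥2 t∈ p ¬q = ¬¬-listed X≥2 u λ (l , l∈ , agree) →
    let t≡ = Rep-unique (Listed≥2 l) (Rep-local X≥2 (Agree-sym agree) p) (proj₂ (Listed-Rep l u))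
    in ¬q (term l (u ∸ 1) ,
           ∈-map⁺ (λ l → term l (u ∸ 1)) (∈-filter⁺ (λ l → term l u ∈T? L) l∈ (subst (_∈ L) t≡ t∈)) ,
           Rep-local (Listed≥2 l) (Agree-≤ (m∸n≤m u 1) agree) (proj₂ (Listed-Rep l (u ∸ 1))))

-- Termination of Goodstein sequences

module _ (𝓑 : DynamicalHierarchy) (m : ℕ) where

  open DynamicalHierarchy 𝓑

  G-suc : ∀ i → G 𝓑 i m ≢ 0 → G 𝓑 (suc i) m ≡ GoodSuccessor.up (good i) (G 𝓑 i m) ∸ 1
  G-suc i ≢0 with G 𝓑 i m
  ... | zero  = ⊥-elim (≢0 refl)
  ... | suc _ = refl

  -- Recursion on the accessibility of the candidate list. Whether the sequence has reached 0 is
  -- decided at each stage, so the double negation in the invariant never has to be removed.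
  terminates : ∀ {L} → Acc _≪_ L → ∀ i → ¬ ¬ (∃ λ t → t ∈ L × Rep (B i) (G 𝓑 i m) t) →
               ∃ λ j → G 𝓑 j m ≡ 0
  terminates {L} (acc rec) i inv with G 𝓑 i m ≟ 0
  ... | yes ≡0 = i , ≡0
  ... | no ≢0 = terminates (rec (nonempty , candidates-dominated L u 0<u)) (suc i) inv'
    where
    open Upgrade (base i) (base (suc i)) (good i)
    u = GoodSuccessor.up (good i) (G 𝓑 i m)
    0<u : 0 < u
    0<u = ≤-<-trans z≤n (up-mono (n≢0⇒n>0 ≢0))
    inv' : ¬ ¬ (∃ λ t → t ∈ candidates L u × Rep (B (suc i)) (G 𝓑 (suc i) m) t)
    inv' ¬p = inv λ (t , t∈ , p) →
      candidates-complete L u (BaseHierarchy.≥2 (base (suc i))) t∈ (Rep-up p) λ (t' , t'∈ , p') →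
      ¬p (t' , t'∈ , subst (λ n → Rep (B (suc i)) n t') (sym (G-suc i ≢0)) p')
    -- Being a negation, this follows from the double-negated invariant: an empty list could not
    -- contain the term.
    nonempty : candidates L u ≢ []
    nonempty eq = inv' λ (t' , t'∈ , _) → absurd (subst (t' ∈_) eq t'∈)
      where
      absurd : ∀ {t} → ¬ (t ∈ [])
      absurd ()

theorem4p12 : (𝓑 : DynamicalHierarchy) (m : ℕ) → ∃ λ i → G 𝓑 i m ≡ 0
theorem4p12 𝓑 m = terminates 𝓑 m (≪-wellFounded initial) 0 λ ¬p →
  ¬¬-listed B₀≥2 m λ (l , l∈ , agree) →
  ¬p (term l m , ∈-map⁺ (λ l → term l m) l∈ , Rep-local (Listed≥2 l) agree (proj₂ (Listed-Rep l m)))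
  where
  B₀≥2 = BaseHierarchy.≥2 (DynamicalHierarchy.base 𝓑 0)
  initial : List T
  -- At the start every possible set of bases up to `m` is allowed.
  initial = map (λ l → term l m) (subsets (suc m))
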